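{- Let $G^\sigma$ be a connected oriented unicyclic graph and $C^\sigma$ its unique cycle. (1) If there exists a vertex $v\in V(C^\sigma)$ which is saturated in $G^\sigma\{v\}$, then $sr(G^\sigma)=sr(G^\sigma\{v\})+sr(G^\sigma-G^\sigma\{v\})$. (2) If no vertex $v\in V(C^\sigma)$ is saturated in $G^\sigma\{v\}$, then $sr(G^\sigma)=sr(C^\sigma)+sr(G^\sigma-C^\sigma)$.
   Context: An oriented graph $G^\sigma$ is a simple graph $G$ together with an orientation of each edge. Its skew-adjacency matrix $S(G^\sigma)=(s_{ij})$ has $s_{ij}=1$ if there is an arc from $v_i$ to $v_j$, $s_{ij}=-1$ if there is an arc from $v_j$ to $v_i$, and $0$ otherwise; the skew-rank $sr(\cdot)$ is the rank of the skew-adjacency matrix (of the induced oriented subgraph in question). For a vertex $v$ on the cycle, $G^\sigma\{v\}$ denotes the oriented tree rooted at $v$ containing $v$, i.e. the component containing $v$ of the graph obtained from $G^\sigma$ by deleting the edges of the cycle. A vertex $v$ of a tree $T$ is saturated in $T$ if every maximum matching of $T$ contains an edge incident with $v$, and unsaturated otherwise. $G^\sigma-H^\sigma$ denotes deletion of the vertices of $H^\sigma$ together with incident edges. -}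

module Defs where

open import Data.Bool using (if_then_else_)
open import Data.Fin using (Fin; zero; suc; _≟_)
open import Data.Fin.Properties using (any?)
open import Data.List using (List; []; _∷_; _∷ʳ_; length; zip; filter; allFin; lookup)
open import Data.List.Membership.Propositional using (_∈_)
open import Data.List.Membership.Propositional.Properties using (∈-filter⁺; ∈-allFin)
open import Data.List.Relation.Unary.All using (All)
open import Data.List.Relation.Unary.AllPairs using (AllPairs)
open import Data.List.Relation.Unary.Any using (Any; here; there; index)
open import Data.List.Relation.Unary.Unique.Propositional using (Unique)
open import Data.Nat using (ℕ; zero; suc; _≤_)
open import Data.Product using (Σ; ∃; _×_; _,_; proj₁; proj₂; uncurry)
import Data.Product.Properties as Product
open import Data.Rational using (ℚ; 0ℚ; 1ℚ; _+_; _*_; -_; 1/_; NonZero; ≢-nonZero)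
import Data.Rational.Properties as ℚ
open import Data.Rational.Solver using (module +-*-Solver)
open import Data.Sum using (_⊎_; inj₁; inj₂)
open import Data.Vec using (Vec; []; _∷_)
import Data.Vec as Vec
open import Function using (_∘_; _⇔_)
open import Level using (0ℓ)
open import Relation.Binary using (Rel; Decidable; Asymmetric)
open import Relation.Binary.Construct.Closure.ReflexiveTransitive using (Star; ε; _◅_; _◅◅_)
open import Relation.Binary.PropositionalEquality
  using (_≡_; refl; sym; trans; cong; cong₂; module ≡-Reasoning)
open import Relation.Nullary using (¬_; Dec; yes; no; does; ¬?; _×-dec_; _⊎-dec_)
open import Relation.Nullary.Decidable using (map′; decidable-stable)
import Relation.Unary as U
open import Relation.Unary.Properties using (∁?)

open import Algebra.Bundles using (CommutativeRing)
open import Algebra.Properties.Semiring.Sum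
  (CommutativeRing.semiring ℚ.+-*-commutativeRing)
  using (sum; sum-cong-≗; sum-replicate-zero; ∑-distrib-+; *-distribʳ-sum)

------------------------------------------------------------------------
-- Rank of a rational matrix

Matrix : ℕ → ℕ → Set
Matrix m n = Fin m → Fin n → ℚ

LinearlyIndependent : ∀ {m n} → (Fin m → Fin n → ℚ) → Set
LinearlyIndependent {m} {n} v =
  (c : Fin m → ℚ) → (∀ j → sum (λ i → c i * v i j) ≡ 0ℚ) → ∀ i → c i ≡ 0ℚ

-- Gaussian elimination: subtracting multiples of the first row clears the
-- column j₀, in which that row has a nonzero entry.
module Eliminate {m n} (A : Matrix (suc m) n) (j₀ : Fin n) (a≢0 : ¬ (A zero j₀ ≡ 0ℚ)) where

  private
    instance
      a-nonZero : NonZero (A zero j₀)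
      a-nonZero = ≢-nonZero a≢0

    a a⁻¹ : ℚ
    a = A zero j₀
    a⁻¹ = 1/ a

    dot : (Fin m → ℚ) → Fin n → ℚ
    dot c j = sum (λ i → c i * A (suc i) j)

  reduced : Matrix m n
  reduced i j = A (suc i) j + A (suc i) j₀ * (- (a⁻¹ * A zero j))

  private
    dot-reduced : ∀ c j →
      sum (λ i → c i * reduced i j) ≡ dot c j + dot c j₀ * (- (a⁻¹ * A zero j))
    dot-reduced c j = begin
      sum (λ i → c i * reduced i j)
        ≡⟨ sum-cong-≗ (λ i → solve 4
             (λ x p q r → x :* (p :+ q :* r) := x :* p :+ x :* q :* r) refl
             (c i) (A (suc i) j) (A (suc i) j₀) k) ⟩
      sum (λ i → c i * A (suc i) j + c i * A (suc i) j₀ * k)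
        ≡⟨ ∑-distrib-+ (λ i → c i * A (suc i) j) (λ i → c i * A (suc i) j₀ * k) ⟩
      dot c j + sum (λ i → c i * A (suc i) j₀ * k)
        ≡⟨ cong (dot c j +_) (sym (*-distribʳ-sum k (λ i → c i * A (suc i) j₀))) ⟩
      dot c j + dot c j₀ * k ∎
      where
      open ≡-Reasoning
      open +-*-Solver
      k = - (a⁻¹ * A zero j)

    -- The coefficient of the first row in a relation is determined by the rest.
    isolate : ∀ {x y} → x * a + y ≡ 0ℚ → x ≡ - (y * a⁻¹)
    isolate {x} {y} eq = begin
      x                                ≡⟨ sym (ℚ.*-identityʳ x) ⟩
      x * 1ℚ                           ≡⟨ cong (x *_) (sym (ℚ.*-inverseʳ a)) ⟩
      x * (a * a⁻¹)                    ≡⟨ solve 4 (λ x y a b → x :* (a :* b) :=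
                                            (x :* a :+ y) :* b :+ :- (y :* b)) refl x y a a⁻¹ ⟩
      (x * a + y) * a⁻¹ + - (y * a⁻¹)  ≡⟨ cong (λ z → z * a⁻¹ + - (y * a⁻¹)) eq ⟩
      0ℚ * a⁻¹ + - (y * a⁻¹)           ≡⟨ cong (_+ - (y * a⁻¹)) (ℚ.*-zeroˡ a⁻¹) ⟩
      0ℚ + - (y * a⁻¹)                 ≡⟨ ℚ.+-identityˡ _ ⟩
      - (y * a⁻¹)                      ∎
      where
      open ≡-Reasoning
      open +-*-Solver

    swap-terms : ∀ p y b z → p + y * (- (b * z)) ≡ (- (y * b)) * z + p
    swap-terms = solve 4 (λ p y b z → p :+ y :* (:- (b :* z)) := (:- (y :* b)) :* z :+ p) refl
      where open +-*-Solver

  independent⁺ : LinearlyIndependent reduced → LinearlyIndependent A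
  independent⁺ ind c rel = λ { zero → c₀≡0 ; (suc i) → tail≡0 i }
    where
    open ≡-Reasoning
    y = dot (c ∘ suc) j₀
    c₀≡ : c zero ≡ - (y * a⁻¹)
    c₀≡ = isolate (rel j₀)
    tail≡0 : ∀ i → c (suc i) ≡ 0ℚ
    tail≡0 = ind (c ∘ suc) λ j → begin
      sum (λ i → c (suc i) * reduced i j)                     ≡⟨ dot-reduced (c ∘ suc) j ⟩
      dot (c ∘ suc) j + y * (- (a⁻¹ * A zero j))              ≡⟨ swap-terms _ y a⁻¹ _ ⟩
      (- (y * a⁻¹)) * A zero j + dot (c ∘ suc) j
        ≡⟨ cong (λ z → z * A zero j + dot (c ∘ suc) j) (sym c₀≡) ⟩
      c zero * A zero j + dot (c ∘ suc) j                     ≡⟨ rel j ⟩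
      0ℚ                                                      ∎
    y≡0 : y ≡ 0ℚ
    y≡0 = trans (sum-cong-≗ (λ i → trans (cong (_* A (suc i) j₀) (tail≡0 i))
                                         (ℚ.*-zeroˡ (A (suc i) j₀))))
                (sum-replicate-zero m)
    c₀≡0 : c zero ≡ 0ℚ
    c₀≡0 = begin
      c zero          ≡⟨ c₀≡ ⟩
      - (y * a⁻¹)     ≡⟨ cong (λ z → - (z * a⁻¹)) y≡0 ⟩
      - (0ℚ * a⁻¹)    ≡⟨ cong -_ (ℚ.*-zeroˡ a⁻¹) ⟩
      0ℚ              ∎

  independent⁻ : LinearlyIndependent A → LinearlyIndependent reduced
  independent⁻ ind c rel i = ind c′ rel′ (suc i)
    where
    c′ : Fin (suc m) → ℚ
    c′ zero    = - (dot c j₀ * a⁻¹)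
    c′ (suc k) = c k
    rel′ : ∀ j → sum (λ k → c′ k * A k j) ≡ 0ℚ
    rel′ j = trans (sym (swap-terms (dot c j) (dot c j₀) a⁻¹ (A zero j)))
                   (trans (sym (dot-reduced c j)) (rel j))

zeroRow-dependent : ∀ {m n} (A : Matrix (suc m) n) →
  (∀ j → A zero j ≡ 0ℚ) → ¬ LinearlyIndependent A
zeroRow-dependent {m} A z ind = 1≢0 (ind e e-rel zero)
  where
  1≢0 : ¬ (1ℚ ≡ 0ℚ)
  1≢0 ()
  e : Fin (suc m) → ℚ
  e zero    = 1ℚ
  e (suc _) = 0ℚ
  e-rel : ∀ j → sum (λ i → e i * A i j) ≡ 0ℚ
  e-rel j = cong₂ _+_
    (trans (ℚ.*-identityˡ _) (z j))
    (trans (sum-cong-≗ (λ i → ℚ.*-zeroˡ (A (suc i) j))) (sum-replicate-zero m))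

linearlyIndependent? : ∀ {m n} (v : Fin m → Fin n → ℚ) → Dec (LinearlyIndependent v)
linearlyIndependent? {zero}  v = yes λ _ _ ()
linearlyIndependent? {suc m} v with any? (λ j → ¬? (v zero j ℚ.≟ 0ℚ))
... | yes (j₀ , v₀≢0) = map′ independent⁺ independent⁻ (linearlyIndependent? reduced)
  where open Eliminate v j₀ v₀≢0
... | no  none = no (zeroRow-dependent v λ j →
  decidable-stable (v zero j ℚ.≟ 0ℚ) λ v₀≢0 → none (j , v₀≢0))

HasIndependentRows : ∀ {m n} → Matrix m n → ℕ → Set
HasIndependentRows {m} A r =
  Σ (Vec (Fin m) r) λ rows → LinearlyIndependent (A ∘ Vec.lookup rows)

anyVec? : ∀ {m r} {P : Vec (Fin m) r → Set} → U.Decidable P → Dec (∃ P)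
anyVec? {r = zero}  P? = map′ (λ p → [] , p) (λ { ([] , p) → p }) (P? [])
anyVec? {r = suc r} P? =
  map′ (λ { (x , xs , p) → x ∷ xs , p }) (λ { (x ∷ xs , p) → x , xs , p })
       (any? λ x → anyVec? λ xs → P? (x ∷ xs))

hasIndependentRows? : ∀ {m n} (A : Matrix m n) → U.Decidable (HasIndependentRows A)
hasIndependentRows? A r = anyVec? λ rows → linearlyIndependent? (A ∘ Vec.lookup rows)

-- The greatest k ≤ b satisfying P, or 0 if there is none.
greatest : {P : ℕ → Set} → U.Decidable P → (b : ℕ) → ℕ
greatest P? zero    = zero
greatest P? (suc b) = if does (P? (suc b)) then suc b else greatest P? b

-- The maximum number of linearly independent rows.  Repeated rows are
-- dependent, so a matrix with m rows has no independent family of more than m.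
rank : ∀ {m n} → Matrix m n → ℕ
rank {m} A = greatest (hasIndependentRows? A) m

------------------------------------------------------------------------
-- Oriented graphs

-- The underlying simple graph is Adj below; asymmetry says both that it is
-- loopless and that every edge carries exactly one direction.
record OrientedGraph (n : ℕ) : Set₁ where
  field
    Arc  : Rel (Fin n) 0ℓ
    arc? : Decidable Arc
    asym : Asymmetric Arc

  Adj : Rel (Fin n) 0ℓ
  Adj i j = Arc i j ⊎ Arc j i

  adj? : Decidable Adj
  adj? i j = arc? i j ⊎-dec arc? j i

  skewAdjacency : Matrix n n
  skewAdjacency i j =
    if does (arc? i j) then 1ℚ else if does (arc? j i) then - 1ℚ else 0ℚ

  Reachable : Rel (Fin n) 0ℓ
  Reachable = Star Adj

  Connected : Set
  Connected = ∀ i j → Reachable i j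

open OrientedGraph public using (Connected)

-- Computed over ℚ; the rank of an integer matrix is the same over ℝ or ℂ.
sr : ∀ {n} → OrientedGraph n → ℕ
sr G = rank (OrientedGraph.skewAdjacency G)

------------------------------------------------------------------------
-- Reachability is decidable (Warshall's algorithm)

module _ {n} (G : OrientedGraph n) where
  open OrientedGraph G

  -- A walk all of whose inner vertices lie in the list.
  data Via : List (Fin n) → Rel (Fin n) 0ℓ where
    stay   : ∀ {i} → Via [] i i
    step   : ∀ {i j} → Adj i j → Via [] i j
    skip   : ∀ {x xs i j} → Via xs i j → Via (x ∷ xs) i j
    detour : ∀ {x xs i j} → Via xs i x → Via xs x j → Via (x ∷ xs) i j

  via? : ∀ xs → Decidable (Via xs)
  via? [] i j =
    map′ (λ { (inj₁ refl) → stay ; (inj₂ e) → step e })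
         (λ { stay → inj₁ refl ; (step e) → inj₂ e })
         (i ≟ j ⊎-dec adj? i j)
  via? (x ∷ xs) i j =
    map′ (λ { (inj₁ p) → skip p ; (inj₂ (p , q)) → detour p q })
         (λ { (skip p) → inj₁ p ; (detour p q) → inj₂ (p , q) })
         (via? xs i j ⊎-dec (via? xs i x ×-dec via? xs x j))

  via-sound : ∀ {xs i j} → Via xs i j → Reachable i j
  via-sound stay         = ε
  via-sound (step e)     = e ◅ ε
  via-sound (skip p)     = via-sound p
  via-sound (detour p q) = via-sound p ◅◅ via-sound q

  via-refl : ∀ xs {i} → Via xs i i
  via-refl []       = stay
  via-refl (x ∷ xs) = skip (via-refl xs)

  via-step : ∀ xs {i j} → Adj i j → Via xs i j
  via-step []       e = step e
  via-step (x ∷ xs) e = skip (via-step xs e)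

  via-trans : ∀ {xs i x j} → x ∈ xs → Via xs i x → Via xs x j → Via xs i j
  via-trans {xs = y ∷ ys} (here refl) p q = detour (first p) (last q)
    where
    first : ∀ {i} → Via (y ∷ ys) i y → Via ys i y
    first (skip p)     = p
    first (detour p _) = p
    last : ∀ {j} → Via (y ∷ ys) y j → Via ys y j
    last (skip q)     = q
    last (detour _ q) = q
  via-trans (there x∈) (skip p)     (skip q)     = skip (via-trans x∈ p q)
  via-trans (there x∈) (skip p)     (detour q r) = detour (via-trans x∈ p q) r
  via-trans (there x∈) (detour p q) (skip r)     = detour p (via-trans x∈ q r)
  via-trans (there x∈) (detour p _) (detour _ r) = detour p r

  via-complete : ∀ {i j} → Reachable i j → Via (allFin n) i j
  via-complete ε       = via-refl (allFin n)
  via-complete (e ◅ w) =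
    via-trans (∈-allFin _) (via-step (allFin n) e) (via-complete w)

  reachable? : Decidable Reachable
  reachable? i j = map′ via-sound via-complete (via? (allFin n) i j)

------------------------------------------------------------------------
-- Subgraphs

-- The vertices of an induced subgraph are renumbered by their position in
-- this list.
members : ∀ {n} {P : U.Pred (Fin n) 0ℓ} → U.Decidable P → List (Fin n)
members {n} P? = filter P? (allFin n)

position : ∀ {n} {P : U.Pred (Fin n) 0ℓ} (P? : U.Decidable P) {i : Fin n} →
  P i → Fin (length (members P?))
position P? {i} Pi = index (∈-filter⁺ P? (∈-allFin i) Pi)

induced : ∀ {n} → OrientedGraph n → {P : U.Pred (Fin n) 0ℓ} (P? : U.Decidable P) →
  OrientedGraph (length (members P?))
induced G P? = record
  { Arc  = λ i j → Arc (lookup (members P?) i) (lookup (members P?) j)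
  ; arc? = λ i j → arc? (lookup (members P?) i) (lookup (members P?) j)
  ; asym = asym
  }
  where open OrientedGraph G

deleteVertices : ∀ {n} → OrientedGraph n → {P : U.Pred (Fin n) 0ℓ} (P? : U.Decidable P) →
  OrientedGraph (length (members (∁? P?)))
deleteVertices G P? = induced G (∁? P?)

keepArcs : ∀ {n} → OrientedGraph n → {E : Rel (Fin n) 0ℓ} → Decidable E → OrientedGraph n
keepArcs G {E} E? = record
  { Arc  = λ i j → Arc i j × E i j
  ; arc? = λ i j → arc? i j ×-dec E? i j
  ; asym = λ p q → asym (proj₁ p) (proj₁ q)
  }
  where open OrientedGraph G

------------------------------------------------------------------------
-- Cycles

cyclicPairs : ∀ {A : Set} → List A → List (A × A)
cyclicPairs []       = []
cyclicPairs (x ∷ xs) = zip (x ∷ xs) (xs ∷ʳ x)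

-- Cycles of the underlying simple graph; the arcs may point either way.
record Cycle {n} (G : OrientedGraph n) : Set where
  open OrientedGraph G using (Adj)
  field
    vertices : List (Fin n)
    3≤length : 3 ≤ length vertices
    distinct : Unique vertices
    closed   : All (uncurry Adj) (cyclicPairs vertices)

  Edge : Rel (Fin n) 0ℓ
  Edge i j = (i , j) ∈ cyclicPairs vertices ⊎ (j , i) ∈ cyclicPairs vertices

  open import Data.List.Membership.DecPropositional (Product.≡-dec (_≟_ {n}) _≟_)
    using () renaming (_∈?_ to _∈ₚ?_)
  open import Data.List.Membership.DecPropositional (_≟_ {n}) using (_∈?_)

  edge? : Decidable Edge
  edge? i j = ((i , j) ∈ₚ? cyclicPairs vertices) ⊎-dec ((j , i) ∈ₚ? cyclicPairs vertices)

  vertex? : U.Decidable (_∈ vertices)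
  vertex? i = i ∈? vertices

-- A vertex list determines a cycle only up to rotation and reflection, so
-- cycles are compared by their edges.
IsUniqueCycle : ∀ {n} (G : OrientedGraph n) → Cycle G → Set
IsUniqueCycle G C = (D : Cycle G) → ∀ i j → Cycle.Edge C i j ⇔ Cycle.Edge D i j

module _ {n} (G : OrientedGraph n) (C : Cycle G) where
  open Cycle C

  cycleGraph : OrientedGraph (length (members vertex?))
  cycleGraph = induced (keepArcs G edge?) vertex?

  withoutCycle : OrientedGraph (length (members (∁? vertex?)))
  withoutCycle = deleteVertices G vertex?

  withoutCycleEdges : OrientedGraph n
  withoutCycleEdges = keepArcs G (λ i j → ¬? (edge? i j))

  inTree? : ∀ v → U.Decidable (OrientedGraph.Reachable withoutCycleEdges v)
  inTree? = reachable? withoutCycleEdges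

  -- G{v} and G − G{v}.
  treeAt : ∀ v → OrientedGraph (length (members (inTree? v)))
  treeAt v = induced withoutCycleEdges (inTree? v)

  withoutTreeAt : ∀ v → OrientedGraph (length (members (∁? (inTree? v))))
  withoutTreeAt v = deleteVertices G (inTree? v)

  -- The vertex v, as a vertex of G{v}.
  root : ∀ v → Fin (length (members (inTree? v)))
  root v = position (inTree? v) ε

------------------------------------------------------------------------
-- Matchings

Incident : ∀ {n} → Fin n → Fin n × Fin n → Set
Incident v (i , j) = v ≡ i ⊎ v ≡ j

Disjoint : ∀ {n} → Rel (Fin n × Fin n) 0ℓ
Disjoint e f = ∀ v → Incident v e → ¬ Incident v f

module _ {n} (G : OrientedGraph n) where
  open OrientedGraph G using (Arc)

  -- An edge of the underlying graph is listed as its arc, hence in one way only.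
  IsMatching : List (Fin n × Fin n) → Set
  IsMatching M = All (uncurry Arc) M × AllPairs Disjoint M

  IsMaximumMatching : List (Fin n × Fin n) → Set
  IsMaximumMatching M = IsMatching M × (∀ N → IsMatching N → length N ≤ length M)

  Saturated : Fin n → Set
  Saturated v = ∀ M → IsMaximumMatching M → Any (Incident v) M

{-# OPTIONS --safe #-}
module Submission where

-- Deleting the cycle edges leaves a forest in which every tree is rooted at
-- its unique cycle vertex.  Play the game of moving to a child on it, where a
-- vertex wins if some child loses.  The winning vertices form a vertex cover
-- and choosing a losing child for each gives a matching of the same size, so
-- by König's argument a cycle vertex v is saturated in G{v} exactly if it
-- wins.  Propagating signs down the tree from v produces a vector x supported
-- on the losing vertices with S x = e_v if v wins, and with S x = 0, x_v = 1
-- if v loses, where S is the skew-adjacency matrix of the forest.  Such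
-- vectors clear the off-diagonal blocks of the skew-adjacency matrix of G by
-- elimination with the columns in G{v}, respectively outside the cycle;
-- skew-symmetry makes the correction to the remaining block vanish, so the
-- ranks of the two diagonal blocks add up.

open import Defs
open import Algebra.Bundles using (CommutativeRing)
open import Data.Fin using (Fin; zero; suc; _≟_; splitAt; join; _↑ˡ_; _↑ʳ_; punchIn; punchOut)
open import Data.Fin.Induction using (spo-noetherian)
open import Data.Fin.Properties
  using (any?; injective⇒≤; punchIn-punchOut; join-splitAt; splitAt-↑ˡ; splitAt-↑ʳ)
open import Data.List using (List; []; _∷_; _∷ʳ_; length; zip; filter; allFin; lookup; tabulate)
open import Data.List.Membership.Propositional using (_∈_)
open import Data.List.Membership.Propositional.Properties
  using (∈-filter⁺; ∈-filter⁻; ∈-allFin; ∈-lookup; ∈-++⁻)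
open import Data.List.Properties using (length-tabulate)
open import Data.List.Relation.Unary.All using (All; []; _∷_)
import Data.List.Relation.Unary.All as All
import Data.List.Relation.Unary.All.Properties as All
open import Data.List.Relation.Unary.AllPairs using (AllPairs; []; _∷_)
import Data.List.Relation.Unary.AllPairs.Properties as AllPairs
open import Data.List.Relation.Unary.Any using (here; there)
import Data.List.Relation.Unary.Any as Any
import Data.List.Relation.Unary.Any.Properties as Any
open import Data.List.Relation.Unary.Unique.Propositional using (Unique)
import Data.List.Relation.Unary.Unique.Propositional.Properties as Unique
open import Data.Nat using (ℕ; zero; suc; _≤_; z≤n; s≤s)
import Data.Nat as ℕ
import Data.Nat.Properties as ℕ
open import Data.Product using (Σ; ∃; _×_; _,_; proj₁; proj₂; uncurry)
open import Data.Rational using (ℚ; 0ℚ; 1ℚ; _+_; _*_; -_; 1/_; ≢-nonZero)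
import Data.Rational.Properties as ℚ
open import Data.Rational.Solver using (module +-*-Solver)
open import Data.Sum using (_⊎_; inj₁; inj₂; [_,_]′)
import Data.Sum as Sum
import Data.Vec as Vec
import Data.Vec.Properties as Vec
open import Data.Vec.Functional using (Vector) renaming (_∷_ to _◂_)
open import Function using (_∘_; const; flip; Equivalence)
open import Induction.WellFounded
  using (WellFounded; Acc; acc; acc-inverse; wf⇒asym; wf⇒irrefl; module Subrelation)
open import Level using (0ℓ)
open import Relation.Binary using (Rel; Decidable; Symmetric; IsStrictPartialOrder)
open import Relation.Binary.Construct.Closure.ReflexiveTransitive using (Star; ε; _◅_; _◅◅_)
import Relation.Binary.Construct.Closure.ReflexiveTransitive as Star
open import Relation.Binary.Construct.Closure.Transitive using (TransClosure; [_])
import Relation.Binary.Construct.Closure.Transitive as Trans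
open import Relation.Binary.PropositionalEquality
open import Relation.Nullary using (¬_; Dec; yes; no; ¬?; contradiction; _⊎-dec_)
open import Relation.Nullary.Decidable using (decidable-stable; map′)
import Relation.Unary as U
open import Relation.Unary.Properties using (∁?)

open import Algebra.Properties.Semiring.Sum
  (CommutativeRing.semiring ℚ.+-*-commutativeRing)
  using (sum; sum-cong-≗; sum-replicate-zero; ∑-distrib-+; ∑-comm; *-distribˡ-sum; *-distribʳ-sum)

open +-*-Solver using (solve; con; _:*_; _:+_; :-_; _:=_)

-- Finite sums of rationals.

sum-zero : ∀ {n} {f : Vector ℚ n} → (∀ i → f i ≡ 0ℚ) → sum f ≡ 0ℚ
sum-zero {n} f≡0 = trans (sum-cong-≗ f≡0) (sum-replicate-zero n)

sum-neg : ∀ {n} (f : Vector ℚ n) → sum (λ i → - f i) ≡ - sum f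
sum-neg {zero}  f = refl
sum-neg {suc n} f = trans (cong (- f zero +_) (sum-neg (f ∘ suc))) (sym (ℚ.neg-distrib-+ (f zero) _))

sum-single : ∀ {n} (f : Vector ℚ n) i → (∀ j → ¬ (j ≡ i) → f j ≡ 0ℚ) → sum f ≡ f i
sum-single f zero    z =
  trans (cong (f zero +_) (sum-zero λ j → z (suc j) λ ())) (ℚ.+-identityʳ (f zero))
sum-single f (suc i) z =
  trans (cong₂ _+_ (z zero λ ()) (sum-single (f ∘ suc) i λ j j≢i → z (suc j) λ { refl → j≢i refl }))
        (ℚ.+-identityˡ (f (suc i)))

sum-split : ∀ a {b} (f : Vector ℚ (a ℕ.+ b)) →
  sum f ≡ sum (λ i → f (i ↑ˡ b)) + sum (λ i → f (a ↑ʳ i))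
sum-split zero    f = sym (ℚ.+-identityˡ _)
sum-split (suc a) f = trans (cong (f zero +_) (sum-split a (f ∘ suc))) (sym (ℚ.+-assoc (f zero) _ _))

-- Linear combinations and spans

combine : ∀ {m n} → Vector ℚ m → Matrix m n → Vector ℚ n
combine c v j = sum λ i → c i * v i j

weighted-cong : ∀ {m} (c : Vector ℚ m) {x y : Vector ℚ m} →
  (∀ i → x i ≡ y i) → sum (λ i → c i * x i) ≡ sum (λ i → c i * y i)
weighted-cong c eq = sum-cong-≗ λ i → cong (c i *_) (eq i)

weighted-zero : ∀ {m} (c : Vector ℚ m) {x : Vector ℚ m} → (∀ i → x i ≡ 0ℚ) → sum (λ i → c i * x i) ≡ 0ℚ
weighted-zero c x≡0 = sum-zero λ i → trans (cong (c i *_) (x≡0 i)) (ℚ.*-zeroʳ (c i))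

combine-assoc : ∀ {l m n} (c : Vector ℚ l) (d : Matrix l m) (v : Matrix m n) j →
  combine c (λ i → combine (d i) v) j ≡ combine (combine c d) v j
combine-assoc c d v j = begin
  sum (λ i → c i * sum (λ k → d i k * v k j))
    ≡⟨ sum-cong-≗ (λ i → *-distribˡ-sum (c i) (λ k → d i k * v k j)) ⟩
  sum (λ i → sum (λ k → c i * (d i k * v k j)))
    ≡⟨ ∑-comm (λ i k → c i * (d i k * v k j)) ⟩
  sum (λ k → sum (λ i → c i * (d i k * v k j)))
    ≡⟨ sum-cong-≗ (λ k → sum-cong-≗ (λ i → sym (ℚ.*-assoc (c i) (d i k) (v k j)))) ⟩
  sum (λ k → sum (λ i → c i * d i k * v k j))
    ≡⟨ sum-cong-≗ (λ k → sym (*-distribʳ-sum (v k j) (λ i → c i * d i k))) ⟩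
  combine (combine c d) v j ∎
  where open ≡-Reasoning

combine-+ : ∀ {m n} (c d : Vector ℚ m) (v : Matrix m n) j →
  combine (λ i → c i + d i) v j ≡ combine c v j + combine d v j
combine-+ c d v j = trans
  (sum-cong-≗ λ i → ℚ.*-distribʳ-+ (v i j) (c i) (d i))
  (∑-distrib-+ (λ i → c i * v i j) (λ i → d i * v i j))

combine-neg : ∀ {m n} (c : Vector ℚ m) (v : Matrix m n) j →
  combine (λ i → - c i) v j ≡ - combine c v j
combine-neg c v j = trans
  (sum-cong-≗ λ i → sym (ℚ.neg-distribˡ-* (c i) (v i j)))
  (sum-neg λ i → c i * v i j)

combine-zeroˡ : ∀ {m n} {c : Vector ℚ m} (v : Matrix m n) j → (∀ i → c i ≡ 0ℚ) → combine c v j ≡ 0ℚ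
combine-zeroˡ v j c≡0 = sum-zero λ i → trans (cong (_* v i j) (c≡0 i)) (ℚ.*-zeroˡ (v i j))

InSpan : ∀ {m n} → Matrix m n → Vector ℚ n → Set
InSpan {m} v w = Σ (Vector ℚ m) λ c → ∀ j → w j ≡ combine c v j

unit : ∀ {n} → Fin n → Vector ℚ n
unit i j with j ≟ i
... | yes _ = 1ℚ
... | no _  = 0ℚ

unit-diagonal : ∀ {n} (i : Fin n) → unit i i ≡ 1ℚ
unit-diagonal i with i ≟ i
... | yes _   = refl
... | no  i≢i = contradiction refl i≢i

unit-off : ∀ {n} (i j : Fin n) → ¬ (j ≡ i) → unit i j ≡ 0ℚ
unit-off i j j≢i with j ≟ i
... | yes j≡i = contradiction j≡i j≢i
... | no _    = refl

sum-unit : ∀ {n} (f : Vector ℚ n) i → sum (λ j → f j * unit i j) ≡ f i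
sum-unit f i = begin
  sum (λ j → f j * unit i j)
    ≡⟨ sum-single _ i (λ j j≢i → trans (cong (f j *_) (unit-off i j j≢i)) (ℚ.*-zeroʳ (f j))) ⟩
  f i * unit i i ≡⟨ cong (f i *_) (unit-diagonal i) ⟩
  f i * 1ℚ       ≡⟨ ℚ.*-identityʳ (f i) ⟩
  f i            ∎
  where open ≡-Reasoning

span-member : ∀ {m n} (v : Matrix m n) i → InSpan v (v i)
span-member v i = unit i , λ j → sym (trans
  (sum-cong-≗ λ k → ℚ.*-comm (unit i k) (v k j)) (sum-unit (λ k → v k j) i))

span-resp : ∀ {m n} {v : Matrix m n} {w w′ : Vector ℚ n} → (∀ j → w′ j ≡ w j) → InSpan v w → InSpan v w′
span-resp eq (c , w≡) = c , λ j → trans (eq j) (w≡ j)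

span-+ : ∀ {m n} {v : Matrix m n} {w w′ : Vector ℚ n} →
  InSpan v w → InSpan v w′ → InSpan v (λ j → w j + w′ j)
span-+ {v = v} (c , w≡) (c′ , w′≡) =
  (λ i → c i + c′ i) , λ j → trans (cong₂ _+_ (w≡ j) (w′≡ j)) (sym (combine-+ c c′ v j))

span-combine : ∀ {l m n} {v : Matrix m n} {u : Matrix l n} →
  (∀ i → InSpan v (u i)) → ∀ c → InSpan v (combine c u)
span-combine {v = v} u∈ c = combine c (proj₁ ∘ u∈) , λ j →
  trans (weighted-cong c λ i → proj₂ (u∈ i) j) (combine-assoc c (proj₁ ∘ u∈) v j)

-- Independence

independent-cong : ∀ {m n} {v w : Matrix m n} → (∀ i j → v i j ≡ w i j) →
  LinearlyIndependent v → LinearlyIndependent w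
independent-cong eq ind c rel = ind c λ j → trans (weighted-cong c λ i → eq i j) (rel j)

module _ {m n} (A : Matrix (suc m) n) (j₀ : Fin n) (a≢0 : ¬ (A zero j₀ ≡ 0ℚ)) where
  open Eliminate A j₀ a≢0

  reduced-pivot : ∀ i → reduced i j₀ ≡ 0ℚ
  reduced-pivot i = begin
    x + x * (- (a⁻¹ * a)) ≡⟨ cong (λ z → x + x * (- z)) (ℚ.*-inverseˡ a) ⟩
    x + x * (- 1ℚ)        ≡⟨ solve 1 (λ x → x :+ x :* (:- con 1ℚ) := con 0ℚ) refl x ⟩
    0ℚ                    ∎
    where
    open ≡-Reasoning
    instance a-nonZero = ≢-nonZero a≢0
    x = A (suc i) j₀
    a = A zero j₀
    a⁻¹ = 1/ a

pivot : ∀ {m n} (v : Matrix (suc m) n) → LinearlyIndependent v → ∃ λ j → ¬ (v zero j ≡ 0ℚ)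
pivot v ind with any? (λ j → ¬? (v zero j ℚ.≟ 0ℚ))
... | yes p    = p
... | no  none = contradiction ind (zeroRow-dependent v λ j →
  decidable-stable (v zero j ℚ.≟ 0ℚ) λ v₀≢0 → none (j , v₀≢0))

-- Elimination with the first row clears its pivot column in the other rows. Deleting that row and
-- that column keeps independence, and both counts drop by one.
independent⇒≤ : ∀ {m n} (v : Matrix m n) → LinearlyIndependent v → m ≤ n
independent⇒≤ {zero}          v ind = z≤n
independent⇒≤ {suc m} {zero}  v ind with () ← proj₁ (pivot v ind)
independent⇒≤ {suc m} {suc n} v ind with j₀ , v₀≢0 ← pivot v ind =
  s≤s (independent⇒≤ (λ i j → reduced i (punchIn j₀ j)) dropPivot)
  where
  open Eliminate v j₀ v₀≢0
  dropPivot : LinearlyIndependent (λ i j → reduced i (punchIn j₀ j))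
  dropPivot c rel = independent⁻ ind c rel′
    where
    rel′ : ∀ j → combine c reduced j ≡ 0ℚ
    rel′ j with j₀ ≟ j
    ... | yes refl = weighted-zero c (reduced-pivot v j₀ v₀≢0)
    ... | no j₀≢j  = subst (λ k → combine c reduced k ≡ 0ℚ) (punchIn-punchOut j₀≢j) (rel (punchOut j₀≢j))

-- A relation among the coefficient vectors with respect to `w` carries over to `v`, so these `m`
-- vectors of length `k` are independent.
steinitz : ∀ {m k n} {v : Matrix m n} (w : Matrix k n) →
  LinearlyIndependent v → (∀ i → InSpan w (v i)) → m ≤ k
steinitz {v = v} w ind v∈ = independent⇒≤ (proj₁ ∘ v∈) λ c rel → ind c λ j → begin
  combine c v j                                ≡⟨ weighted-cong c (λ i → proj₂ (v∈ i) j) ⟩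
  combine c (λ i → combine (proj₁ (v∈ i)) w) j ≡⟨ combine-assoc c (proj₁ ∘ v∈) w j ⟩
  combine (combine c (proj₁ ∘ v∈)) w j         ≡⟨ combine-zeroˡ w j rel ⟩
  0ℚ                                           ∎
  where open ≡-Reasoning

independent-swap : ∀ {m n} (u w : Vector ℚ n) (v : Matrix m n) →
  LinearlyIndependent (u ◂ w ◂ v) → LinearlyIndependent (w ◂ u ◂ v)
independent-swap u w v ind c rel = λ
  { zero          → all (suc zero)
  ; (suc zero)    → all zero
  ; (suc (suc i)) → all (suc (suc i)) }
  where
  all = ind (c (suc zero) ◂ c zero ◂ (λ i → c (suc (suc i)))) λ j →
    trans (solve 3 (λ x y z → x :+ (y :+ z) := y :+ (x :+ z)) refl
            (c (suc zero) * u j) (c zero * w j) _)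
          (rel j)

combine-eliminated : ∀ {m n} (c : Vector ℚ m) (v : Matrix m n) j₀ k j →
  sum (λ i → c i * (v i j + v i j₀ * k)) ≡ combine c v j + combine c v j₀ * k
combine-eliminated c v j₀ k j = begin
  sum (λ i → c i * (v i j + v i j₀ * k))
    ≡⟨ sum-cong-≗ (λ i → solve 4 (λ x p q r → x :* (p :+ q :* r) := x :* p :+ x :* q :* r)
         refl (c i) (v i j) (v i j₀) k) ⟩
  sum (λ i → c i * v i j + c i * v i j₀ * k)
    ≡⟨ ∑-distrib-+ (λ i → c i * v i j) (λ i → c i * v i j₀ * k) ⟩
  combine c v j + sum (λ i → c i * v i j₀ * k)
    ≡⟨ cong (combine c v j +_) (sym (*-distribʳ-sum k (λ i → c i * v i j₀))) ⟩
  combine c v j + combine c v j₀ * k ∎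
  where open ≡-Reasoning

-- Undoes the elimination in `span⊎independent`: `x`, `y` belong to the new vector and `d`, `e` to a
-- combination of the old ones, at the current and the pivot column; `z` is the entry of the pivot
-- row and `b` the inverse of the pivot. The factor of `z` is the coefficient of the pivot row.
back-substitute : ∀ x y d e z b → x + y * (- (b * z)) ≡ d + e * (- (b * z)) →
  x ≡ (- ((e + - y) * b)) * z + d
back-substitute x y d e z b eq = begin
  x                                           ≡⟨ solve 2 (λ x t → x := (x :+ t) :+ :- t) refl x (y * (- (b * z))) ⟩
  (x + y * (- (b * z))) + - (y * (- (b * z))) ≡⟨ cong (_+ - (y * (- (b * z)))) eq ⟩
  (d + e * (- (b * z))) + - (y * (- (b * z)))
    ≡⟨ solve 5 (λ d e b z y → (d :+ e :* (:- (b :* z))) :+ :- (y :* (:- (b :* z)))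
                  := (:- ((e :+ :- y) :* b)) :* z :+ d) refl d e b z y ⟩
  (- ((e + - y) * b)) * z + d                 ∎
  where open ≡-Reasoning

-- Induction on the number of rows: the first row of `v` eliminates its pivot column from `w` and
-- the other rows, and either alternative for the reduced vectors lifts back.
span⊎independent : ∀ {m n} (v : Matrix m n) (w : Vector ℚ n) → LinearlyIndependent v →
  InSpan v w ⊎ LinearlyIndependent (w ◂ v)
span⊎independent {zero} v w ind with any? (λ j → ¬? (w j ℚ.≟ 0ℚ))
... | yes (j , wj≢0) = inj₂ (Eliminate.independent⁺ (w ◂ v) j wj≢0 λ _ _ ())
... | no none        = inj₁ ((λ ()) , λ j →
  decidable-stable (w j ℚ.≟ 0ℚ) λ wj≢0 → none (j , wj≢0))
span⊎independent {suc m} {n} v w ind = [ inj₁ ∘ spanned , inj₂ ∘ independent ]′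
  (span⊎independent (E.reduced ∘ suc) (E.reduced zero)
    (Eliminate.independent⁻ v j₀ v₀≢0 ind))
  where
  j₀ = proj₁ (pivot v ind)
  v₀≢0 = proj₂ (pivot v ind)
  -- The pivot row must come first for `Eliminate`; `independent-swap` later moves `w` to the front.
  u : Matrix (suc (suc m)) n
  u = v zero ◂ w ◂ v ∘ suc
  module E = Eliminate u j₀ v₀≢0
  instance v₀-nonZero = ≢-nonZero v₀≢0
  v₀⁻¹ : ℚ
  v₀⁻¹ = 1/ v zero j₀
  spanned : InSpan (E.reduced ∘ suc) (E.reduced zero) → InSpan v w
  spanned (c , eq) = ((- ((combine c (v ∘ suc) j₀ + - w j₀) * v₀⁻¹)) ◂ c) , λ j →
    back-substitute (w j) (w j₀)
      (combine c (v ∘ suc) j) (combine c (v ∘ suc) j₀) (v zero j) v₀⁻¹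
      (trans (eq j) (combine-eliminated c (v ∘ suc) j₀ (- (v₀⁻¹ * v zero j)) j))
  independent : LinearlyIndependent (E.reduced zero ◂ E.reduced ∘ suc) → LinearlyIndependent (w ◂ v)
  independent ind′ = independent-cong {v = w ◂ v zero ◂ v ∘ suc} {w = w ◂ v}
    (λ { zero _ → refl ; (suc zero) _ → refl ; (suc (suc i)) _ → refl })
    (independent-swap (v zero) w (v ∘ suc)
      (E.independent⁺ (independent-cong {v = E.reduced zero ◂ E.reduced ∘ suc} {w = E.reduced}
        (λ { zero _ → refl ; (suc i) _ → refl }) ind′)))

-- Rank

-- A certificate that determines `rank`, which itself is defined by a search over row indices.
RowBasis : ∀ {m n} → Matrix m n → ℕ → Set
RowBasis {m} A r = Σ (Fin r → Fin m) λ ρ →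
  LinearlyIndependent (A ∘ ρ) × (∀ i → InSpan (A ∘ ρ) (A i))

rowBasis-cong : ∀ {m n r} {A B : Matrix m n} → (∀ i j → A i j ≡ B i j) → RowBasis A r → RowBasis B r
rowBasis-cong eq (ρ , ind , spans) =
  ρ , independent-cong (λ i j → eq (ρ i) j) ind ,
  λ i → proj₁ (spans i) , λ j →
    trans (sym (eq i j)) (trans (proj₂ (spans i) j) (weighted-cong (proj₁ (spans i)) λ k → eq (ρ k) j))

module _ {P : ℕ → Set} (P? : U.Decidable P) where

  greatest-satisfies : P 0 → ∀ b → P (greatest P? b)
  greatest-satisfies p₀ zero    = p₀
  greatest-satisfies p₀ (suc b) with P? (suc b)
  ... | yes p = p
  ... | no _  = greatest-satisfies p₀ b

  ≤-greatest : ∀ b {k} → k ≤ b → P k → k ≤ greatest P? b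
  ≤-greatest zero    k≤b p = k≤b
  ≤-greatest (suc b) k≤b p with P? (suc b)
  ... | yes _ = k≤b
  ... | no ¬p = ≤-greatest b (ℕ.≤-pred (ℕ.≤∧≢⇒< k≤b λ { refl → ¬p p })) p

module _ {m n} (A : Matrix m n) where

  independentRows-bound : ∀ {r} (ρ : Fin r → Fin m) → LinearlyIndependent (A ∘ ρ) → r ≤ rank A
  independentRows-bound {r} ρ ind = ≤-greatest (hasIndependentRows? A) m
    -- The search defining `rank` stops at `m`, so `r ≤ m` has to be supplied.
    (steinitz A ind λ i → span-member A (ρ i))
    (Vec.tabulate ρ , independent-cong
      (λ i j → cong (λ k → A k j) (sym (Vec.lookup∘tabulate ρ i))) ind)

  maximalRows : HasIndependentRows A (rank A)
  maximalRows = greatest-satisfies (hasIndependentRows? A) (Vec.[] , λ _ _ ()) m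

  -- A row outside the span of the maximal family would extend it to `suc (rank A)` independent
  -- rows.
  rank-rowBasis : RowBasis A (rank A)
  rank-rowBasis = ρ , ind , spans
    where
    ρ : Fin (rank A) → Fin m
    ρ = Vec.lookup (proj₁ maximalRows)
    ind : LinearlyIndependent (A ∘ ρ)
    ind = proj₂ maximalRows
    spans : ∀ i → InSpan (A ∘ ρ) (A i)
    spans i with span⊎independent (A ∘ ρ) (A i) ind
    ... | inj₁ s    = s
    ... | inj₂ ind′ = contradiction
      (independentRows-bound (i ◂ ρ) (independent-cong {v = A i ◂ A ∘ ρ} {w = A ∘ (i ◂ ρ)}
        (λ { zero _ → refl ; (suc _) _ → refl }) ind′))
      ℕ.1+n≰n

  rowBasis⇒rank : ∀ {r} → RowBasis A r → rank A ≡ r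
  rowBasis⇒rank (ρ , ind , spans) = ℕ.≤-antisym
    (steinitz (A ∘ ρ) (proj₂ maximalRows) λ i → spans (Vec.lookup (proj₁ maximalRows) i))
    (independentRows-bound ρ ind)

rank-cong : ∀ {m n} {A B : Matrix m n} → (∀ i j → A i j ≡ B i j) → rank A ≡ rank B
rank-cong {A = A} {B} eq = sym (rowBasis⇒rank B (rowBasis-cong eq (rank-rowBasis A)))

-- Block elimination: the columns of X exhibit the off-diagonal block as a
-- combination of the columns of the first diagonal block, with vanishing
-- contribution to the Schur complement.
module BlockElimination {n k l} (A : Matrix n n) (skew : ∀ i j → A i j ≡ - A j i)
  (p : Fin k → Fin n) (q : Fin l → Fin n) (cover : ∀ i → (∃ λ a → p a ≡ i) ⊎ (∃ λ b → q b ≡ i))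
  (X : Matrix l k)
  (offDiagonal : ∀ a b → sum (λ a′ → A (p a) (p a′) * X b a′) ≡ A (p a) (q b))
  (complement : ∀ b b′ → sum (λ a → A (q b) (p a) * X b′ a) ≡ 0ℚ)
  where
  open ≡-Reasoning

  B : Matrix k k
  B a a′ = A (p a) (p a′)

  D : Matrix l l
  D b b′ = A (q b) (q b′)

  byCover : {Q : Fin n → Set} → (∀ a → Q (p a)) → (∀ b → Q (q b)) → ∀ i → Q i
  byCover onP onQ i with cover i
  ... | inj₁ (a , refl) = onP a
  ... | inj₂ (b , refl) = onQ b

  -- Skew-symmetry turns the column identities given by `X` into row identities, up to sign.
  transposed : ∀ b j → combine (X b) (A ∘ p) j ≡ - sum (λ a → A j (p a) * X b a)
  transposed b j = trans
    (sum-cong-≗ λ a → trans (cong (X b a *_) (skew (p a) j))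
      (solve 2 (λ x y → x :* (:- y) := :- (y :* x)) refl (X b a) (A j (p a))))
    (sum-neg λ a → A j (p a) * X b a)

  combine-X-p : ∀ b a → combine (X b) (A ∘ p) (p a) ≡ A (q b) (p a)
  combine-X-p b a = begin
    combine (X b) (A ∘ p) (p a)             ≡⟨ transposed b (p a) ⟩
    - sum (λ a′ → A (p a) (p a′) * X b a′)  ≡⟨ cong -_ (offDiagonal a b) ⟩
    - A (p a) (q b)                         ≡⟨ sym (skew (q b) (p a)) ⟩
    A (q b) (p a)                           ∎

  combine-X-q : ∀ b b′ → combine (X b) (A ∘ p) (q b′) ≡ 0ℚ
  combine-X-q b b′ = trans (transposed b (q b′)) (cong -_ (complement b′ b))

  module _ {r s} (ρ : Fin r → Fin k) (σ : Fin s → Fin l) where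

    rows : Fin (r ℕ.+ s) → Fin n
    rows i = [ p ∘ ρ , q ∘ σ ]′ (splitAt r i)

    rows-ˡ : ∀ i → rows (i ↑ˡ s) ≡ p (ρ i)
    rows-ˡ i = cong [ p ∘ ρ , q ∘ σ ]′ (splitAt-↑ˡ r i s)

    rows-ʳ : ∀ i → rows (r ↑ʳ i) ≡ q (σ i)
    rows-ʳ i = cong [ p ∘ ρ , q ∘ σ ]′ (splitAt-↑ʳ r s i)

    -- On the columns `p` a relation equates the combination `c₁` of rows of `B` with minus the
    -- combination `c₂` of rows of the lower left block. Applying `X` gives `c₁-q`, because
    -- `complement` kills the right-hand side. A relation among rows of `D` remains on the columns
    -- `q`, so `c₂` vanishes, and then `c₁` does.
    rows-independent : LinearlyIndependent (B ∘ ρ) → LinearlyIndependent (D ∘ σ) →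
      LinearlyIndependent (A ∘ rows)
    rows-independent indB indD c rel i =
      subst (λ i → c i ≡ 0ℚ) (join-splitAt r s i) (byHalves (splitAt r i))
      where
      c₁ = λ i → c (i ↑ˡ s)
      c₂ = λ i → c (r ↑ʳ i)
      rel′ : ∀ j → combine c₁ (A ∘ p ∘ ρ) j + combine c₂ (A ∘ q ∘ σ) j ≡ 0ℚ
      rel′ j = begin
        combine c₁ (A ∘ p ∘ ρ) j + combine c₂ (A ∘ q ∘ σ) j
          ≡⟨ cong₂ _+_ (weighted-cong c₁ λ i → cong (λ t → A t j) (sym (rows-ˡ i)))
                       (weighted-cong c₂ λ i → cong (λ t → A t j) (sym (rows-ʳ i))) ⟩
        combine c₁ (A ∘ rows ∘ (_↑ˡ s)) j + combine c₂ (A ∘ rows ∘ (r ↑ʳ_)) j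
          ≡⟨ sym (sum-split r λ i → c i * A (rows i) j) ⟩
        combine c (A ∘ rows) j
          ≡⟨ rel j ⟩
        0ℚ ∎
      c₁-q : ∀ b → combine c₁ (A ∘ p ∘ ρ) (q b) ≡ 0ℚ
      c₁-q b = begin
        combine c₁ (A ∘ p ∘ ρ) (q b)
          ≡⟨ weighted-cong c₁ (λ i → sym (offDiagonal (ρ i) b)) ⟩
        sum (λ i → c₁ i * sum (λ a → B (ρ i) a * X b a))
          ≡⟨ combine-assoc c₁ (B ∘ ρ) (λ a _ → X b a) b ⟩
        sum (λ a → combine c₁ (B ∘ ρ) a * X b a)
          ≡⟨ sum-cong-≗ (λ a → cong (_* X b a) (opposite a)) ⟩
        sum (λ a → combine (λ i → - c₂ i) (λ i a → A (q (σ i)) (p a)) a * X b a)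
          ≡⟨ sym (combine-assoc (λ i → - c₂ i) (λ i a → A (q (σ i)) (p a)) (λ a _ → X b a) b) ⟩
        sum (λ i → - c₂ i * sum (λ a → A (q (σ i)) (p a) * X b a))
          ≡⟨ weighted-zero (λ i → - c₂ i)
               (λ i → complement (σ i) b) ⟩
        0ℚ ∎
        where
        opposite : ∀ a → combine c₁ (B ∘ ρ) a ≡ combine (λ i → - c₂ i) (λ i a → A (q (σ i)) (p a)) a
        opposite a = begin
          x              ≡⟨ solve 2 (λ x y → x := (x :+ y) :+ :- y) refl x y ⟩
          (x + y) + - y  ≡⟨ cong (_+ - y) (rel′ (p a)) ⟩
          0ℚ + - y       ≡⟨ ℚ.+-identityˡ (- y) ⟩
          - y            ≡⟨ sym (combine-neg c₂ (A ∘ q ∘ σ) (p a)) ⟩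
          combine (λ i → - c₂ i) (A ∘ q ∘ σ) (p a) ∎
          where
          x = combine c₁ (A ∘ p ∘ ρ) (p a)
          y = combine c₂ (A ∘ q ∘ σ) (p a)
      c₂≡0 : ∀ i → c₂ i ≡ 0ℚ
      c₂≡0 = indD c₂ λ b → begin
        combine c₂ (A ∘ q ∘ σ) (q b)       ≡⟨ sym (ℚ.+-identityˡ _) ⟩
        0ℚ + combine c₂ (A ∘ q ∘ σ) (q b) ≡⟨ cong (_+ combine c₂ (A ∘ q ∘ σ) (q b)) (sym (c₁-q b)) ⟩
        combine c₁ (A ∘ p ∘ ρ) (q b) + combine c₂ (A ∘ q ∘ σ) (q b) ≡⟨ rel′ (q b) ⟩
        0ℚ      ∎
      c₁≡0 : ∀ i → c₁ i ≡ 0ℚ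
      c₁≡0 = indB c₁ λ a → begin
        combine c₁ (A ∘ p ∘ ρ) (p a)       ≡⟨ sym (ℚ.+-identityʳ _) ⟩
        combine c₁ (A ∘ p ∘ ρ) (p a) + 0ℚ
          ≡⟨ cong (combine c₁ (A ∘ p ∘ ρ) (p a) +_) (sym (combine-zeroˡ (A ∘ q ∘ σ) (p a) c₂≡0)) ⟩
        combine c₁ (A ∘ p ∘ ρ) (p a) + combine c₂ (A ∘ q ∘ σ) (p a) ≡⟨ rel′ (p a) ⟩
        0ℚ                                 ∎
      byHalves : ∀ h → c (join r s h) ≡ 0ℚ
      byHalves (inj₁ i) = c₁≡0 i
      byHalves (inj₂ i) = c₂≡0 i

    -- A dependence found in `B` extends to the columns `q`, since `X` expresses these through the
    -- columns `p`. The rows `q b` are reduced to rows of `D` by subtracting rows from `p`.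
    rows-span : (∀ a → InSpan (B ∘ ρ) (B a)) → (∀ b → InSpan (D ∘ σ) (D b)) →
      ∀ i → InSpan (A ∘ rows) (A i)
    rows-span spansB spansD = byCover row-p row-q
      where
      row-p : ∀ a → InSpan (A ∘ rows) (A (p a))
      row-p a with c , eq ← spansB a =
        span-resp (byCover eq onQ) (span-combine (λ i →
          subst (InSpan (A ∘ rows) ∘ A) (rows-ˡ i) (span-member (A ∘ rows) (i ↑ˡ s))) c)
        where
        onQ : ∀ b → A (p a) (q b) ≡ combine c (A ∘ p ∘ ρ) (q b)
        onQ b = begin
          A (p a) (q b)                                     ≡⟨ sym (offDiagonal a b) ⟩
          sum (λ a′ → B a a′ * X b a′)                      ≡⟨ sum-cong-≗ (λ a′ → cong (_* X b a′) (eq a′)) ⟩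
          sum (λ a′ → combine c (B ∘ ρ) a′ * X b a′)        ≡⟨ sym (combine-assoc c (B ∘ ρ) (λ a _ → X b a) b) ⟩
          sum (λ i → c i * sum (λ a′ → B (ρ i) a′ * X b a′)) ≡⟨ sum-cong-≗ (λ i → cong (c i *_) (offDiagonal (ρ i) b)) ⟩
          combine c (A ∘ p ∘ ρ) (q b)                       ∎
      -- The row `q b` after elimination: zero on the columns `p`, row `b` of `D` on the columns
      -- `q`.
      cleared : Matrix l n
      cleared b j = A (q b) j + combine (λ a → - X b a) (A ∘ p) j
      cleared≡ : ∀ b j → cleared b j ≡ A (q b) j + - combine (X b) (A ∘ p) j
      cleared≡ b j = cong (A (q b) j +_) (combine-neg (X b) (A ∘ p) j)
      cleared-p : ∀ b a → cleared b (p a) ≡ 0ℚ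
      cleared-p b a = trans (cleared≡ b (p a))
        (trans (cong (λ z → A (q b) (p a) + - z) (combine-X-p b a)) (ℚ.+-inverseʳ (A (q b) (p a))))
      cleared-q : ∀ b b′ → cleared b (q b′) ≡ D b b′
      cleared-q b b′ = trans (cleared≡ b (q b′))
        (trans (cong (λ z → D b b′ + - z) (combine-X-q b b′)) (ℚ.+-identityʳ (D b b′)))
      cleared-σ : ∀ i → InSpan (A ∘ rows) (cleared (σ i))
      cleared-σ i = span-+
        (subst (InSpan (A ∘ rows) ∘ A) (rows-ʳ i) (span-member (A ∘ rows) (r ↑ʳ i)))
        (span-combine row-p λ a → - X (σ i) a)
      row-q : ∀ b → InSpan (A ∘ rows) (A (q b))
      row-q b with d , eq ← spansD b = span-resp restore (span-+
          (span-resp {w′ = cleared b} (byCover onP onQ) (span-combine cleared-σ d)) (span-combine row-p (X b)))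
        where
        onP : ∀ a → cleared b (p a) ≡ combine d (cleared ∘ σ) (p a)
        onP a = trans (cleared-p b a) (sym (weighted-zero d λ i → cleared-p (σ i) a))
        onQ : ∀ b′ → cleared b (q b′) ≡ combine d (cleared ∘ σ) (q b′)
        onQ b′ = trans (cleared-q b b′) (trans (eq b′)
          (weighted-cong d λ i → sym (cleared-q (σ i) b′)))
        restore : ∀ j → A (q b) j ≡ cleared b j + combine (X b) (A ∘ p) j
        restore j = trans
          (solve 2 (λ x y → x := (x :+ :- y) :+ y) refl (A (q b) j) (combine (X b) (A ∘ p) j))
          (cong (_+ combine (X b) (A ∘ p) j) (sym (cleared≡ b j)))

  rank-blocks : rank A ≡ rank B ℕ.+ rank D
  rank-blocks with ρ , indB , spansB ← rank-rowBasis B | σ , indD , spansD ← rank-rowBasis D =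
    rowBasis⇒rank A (rows ρ σ , rows-independent ρ σ indB indD , rows-span ρ σ spansB spansD)

-- Subsets of the vertices as lists

allPairs-lookup : ∀ {A : Set} {R : Rel A 0ℓ} → Symmetric R → ∀ {xs} → AllPairs R xs →
  ∀ {i j} → i ≢ j → R (lookup xs i) (lookup xs j)
allPairs-lookup s (r ∷ rs) {zero}  {zero}  i≢j = contradiction refl i≢j
allPairs-lookup s {x ∷ xs} (r ∷ rs) {zero}  {suc j} i≢j = All.lookup r (∈-lookup {xs = xs} j)
allPairs-lookup s {x ∷ xs} (r ∷ rs) {suc i} {zero}  i≢j = s (All.lookup r (∈-lookup {xs = xs} i))
allPairs-lookup s (r ∷ rs) {suc i} {suc j} i≢j = allPairs-lookup s rs (i≢j ∘ cong suc)

sum-filter : ∀ {A : Set} {P : U.Pred A 0ℓ} (P? : U.Decidable P) (f : A → ℚ) → (∀ x → ¬ P x → f x ≡ 0ℚ) →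
  ∀ xs → sum (f ∘ lookup (filter P? xs)) ≡ sum (f ∘ lookup xs)
sum-filter P? f z [] = refl
sum-filter P? f z (x ∷ xs) with P? x
... | yes _  = cong (f x +_) (sum-filter P? f z xs)
... | no ¬Px = trans (sum-filter P? f z xs)
  (sym (trans (cong (_+ sum (f ∘ lookup xs)) (z x ¬Px)) (ℚ.+-identityˡ (sum (f ∘ lookup xs)))))

sum-lookup-tabulate : ∀ {A : Set} (f : A → ℚ) {n} (g : Fin n → A) →
  sum (f ∘ lookup (tabulate g)) ≡ sum (f ∘ g)
sum-lookup-tabulate f {zero}  g = refl
sum-lookup-tabulate f {suc n} g = cong (f (g zero) +_) (sum-lookup-tabulate f (g ∘ suc))

module _ {n} {P : U.Pred (Fin n) 0ℓ} (P? : U.Decidable P) where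

  member : Fin (length (members P?)) → Fin n
  member = lookup (members P?)

  member-satisfies : ∀ a → P (member a)
  member-satisfies a = proj₂ (∈-filter⁻ P? {xs = allFin n} (∈-lookup {xs = members P?} a))

  member-position : ∀ {i} (Pi : P i) → member (position P? Pi) ≡ i
  member-position Pi = sym (Any.lookup-index (∈-filter⁺ P? (∈-allFin _) Pi))

  member-injective : ∀ {a b} → member a ≡ member b → a ≡ b
  member-injective {a} {b} eq = decidable-stable (a ≟ b) λ a≢b →
    allPairs-lookup (λ x≢y → x≢y ∘ sym) (Unique.filter⁺ P? (Unique.allFin⁺ n)) a≢b eq

  sum-members : ∀ (f : Fin n → ℚ) → (∀ i → ¬ P i → f i ≡ 0ℚ) → sum (f ∘ member) ≡ sum f
  sum-members f z = trans (sum-filter P? f z (allFin n)) (sum-lookup-tabulate f λ i → i)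

  restrict : Matrix n n → Matrix (length (members P?)) (length (members P?))
  restrict A a b = A (member a) (member b)

-- For j outside P, X j solves the linear system given by A with right-hand
-- side the column j of A cut off to P, so that elimination with the columns
-- in P clears the off-diagonal blocks and leaves the block on Q unchanged.
rank-split : ∀ {n} (A : Matrix n n) → (∀ i j → A i j ≡ - A j i) →
  {P Q : U.Pred (Fin n) 0ℓ} (P? : U.Decidable P) (Q? : U.Decidable Q) → (∀ i → P i ⊎ Q i) →
  (X : Matrix n n) →
  (∀ j k → Q j → ¬ P k → X j k ≡ 0ℚ) →
  (∀ i j → P i → Q j → sum (λ k → A i k * X j k) ≡ A i j) →
  (∀ i j → Q i → Q j → sum (λ k → A i k * X j k) ≡ 0ℚ) →
  rank A ≡ rank (restrict P? A) ℕ.+ rank (restrict Q? A)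
rank-split A skew {P} {Q} P? Q? cover X support solves kills =
  BlockElimination.rank-blocks A skew (member P?) (member Q?)
    (λ i → Sum.map (λ Pi → position P? Pi , member-position P? Pi)
                   (λ Qi → position Q? Qi , member-position Q? Qi) (cover i))
    (λ b a → X (member Q? b) (member P? a))
    (λ a b → trans (onP (member P? a) b) (solves _ _ (member-satisfies P? a) (member-satisfies Q? b)))
    (λ b b′ → trans (onP (member Q? b) b′) (kills _ _ (member-satisfies Q? b) (member-satisfies Q? b′)))
  where
  onP : ∀ i b → sum (λ a → A i (member P? a) * X (member Q? b) (member P? a))
              ≡ sum (λ k → A i k * X (member Q? b) k)
  onP i b = sum-members P? (λ k → A i k * X (member Q? b) k) λ k ¬Pk →
    trans (cong (A i k *_) (support _ k (member-satisfies Q? b) ¬Pk)) (ℚ.*-zeroʳ (A i k))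

sum-pair : ∀ {n} (f : Vector ℚ n) {a b} → a ≢ b → (∀ j → j ≢ a → j ≢ b → f j ≡ 0ℚ) →
  sum f ≡ f a + f b
sum-pair f {a} {b} a≢b z = begin
  sum f                                            ≡⟨ sum-cong-≗ pointwise ⟩
  sum (λ j → f j * unit a j + f j * unit b j)      ≡⟨ ∑-distrib-+ (λ j → f j * unit a j) (λ j → f j * unit b j) ⟩
  sum (λ j → f j * unit a j) + sum (λ j → f j * unit b j) ≡⟨ cong₂ _+_ (sum-unit f a) (sum-unit f b) ⟩
  f a + f b                                        ∎
  where
  open ≡-Reasoning
  weights : ∀ j x y → f j * (x + y) ≡ f j → f j ≡ f j * x + f j * y
  weights j x y eq = trans (sym eq) (ℚ.*-distribˡ-+ (f j) x y)
  pointwise : ∀ j → f j ≡ f j * unit a j + f j * unit b j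
  pointwise j with j ≟ a | j ≟ b
  ... | yes refl | yes refl = contradiction refl a≢b
  ... | yes _    | no _     = weights j 1ℚ 0ℚ (ℚ.*-identityʳ (f j))
  ... | no _     | yes _    = weights j 0ℚ 1ℚ (ℚ.*-identityʳ (f j))
  ... | no j≢a   | no j≢b   = weights j 0ℚ 0ℚ (trans (ℚ.*-zeroʳ (f j)) (sym (z j j≢a j≢b)))

-- Skew-adjacency matrices

module _ {n} (G : OrientedGraph n) where
  open OrientedGraph G

  skewAdjacency-skew : ∀ i j → skewAdjacency i j ≡ - skewAdjacency j i
  skewAdjacency-skew i j with arc? i j | arc? j i
  ... | yes p | yes q = contradiction q (asym p)
  ... | yes _ | no _  = refl
  ... | no _  | yes _ = refl
  ... | no _  | no _  = refl

  skewAdjacency-nonadjacent : ∀ {i j} → ¬ Adj i j → skewAdjacency i j ≡ 0ℚ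
  skewAdjacency-nonadjacent {i} {j} ¬adj with arc? i j | arc? j i
  ... | yes p | _     = contradiction (inj₁ p) ¬adj
  ... | no _  | yes q = contradiction (inj₂ q) ¬adj
  ... | no _  | no _  = refl

  skewAdjacency-square : ∀ {i j} → Adj i j → skewAdjacency i j * skewAdjacency i j ≡ 1ℚ
  skewAdjacency-square {i} {j} adj with arc? i j | arc? j i
  ... | yes _ | _     = refl
  ... | no _  | yes _ = refl
  ... | no ¬p | no ¬q = contradiction adj [ ¬p , ¬q ]′

  adj-irreflexive : ∀ {i} → ¬ Adj i i
  adj-irreflexive = [ (λ p → asym p p) , (λ p → asym p p) ]′

  skewAdjacency-keepArcs : ∀ {E : Rel (Fin n) 0ℓ} (E? : Decidable E) {i j} →
    (Arc i j → E i j) → (Arc j i → E j i) →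
    OrientedGraph.skewAdjacency (keepArcs G E?) i j ≡ skewAdjacency i j
  skewAdjacency-keepArcs E? {i} {j} f g with arc? i j | E? i j | arc? j i | E? j i
  ... | yes _ | yes _ | _     | _     = refl
  ... | yes p | no ¬e | _     | _     = contradiction (f p) ¬e
  ... | no _  | _     | yes _ | yes _ = refl
  ... | no _  | _     | yes q | no ¬e = contradiction (g q) ¬e
  ... | no _  | _     | no _  | _     = refl

-- Matchings

disjoint-sym : ∀ {n} → Symmetric (Disjoint {n})
disjoint-sym d v on-f on-e = d v on-e on-f

-- König's argument: a vertex cover all of whose vertices are matched to
-- distinct vertices outside the cover certifies the matching as maximum, and
-- then every maximum matching meets the cover in each of its vertices.
module MatchedCover {m} (H : OrientedGraph m) {k} (cover mate : Fin k → Fin m)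
  (cover-injective : ∀ {a b} → cover a ≡ cover b → a ≡ b)
  (mate-injective : ∀ {a b} → mate a ≡ mate b → a ≡ b)
  (cover≢mate : ∀ a b → cover a ≢ mate b)
  (adjacent : ∀ a → OrientedGraph.Adj H (cover a) (mate a))
  (covers : ∀ {i j} → OrientedGraph.Arc H i j → (∃ λ a → cover a ≡ i) ⊎ (∃ λ a → cover a ≡ j))
  where
  open OrientedGraph H

  arcOf : ∀ {i j} → Adj i j → Fin m × Fin m
  arcOf {i} {j} (inj₁ _) = i , j
  arcOf {i} {j} (inj₂ _) = j , i

  arcOf-arc : ∀ {i j} (e : Adj i j) → uncurry Arc (arcOf e)
  arcOf-arc (inj₁ p) = p
  arcOf-arc (inj₂ p) = p

  arcOf-incident : ∀ {i j} (e : Adj i j) {v} → Incident v (arcOf e) → v ≡ i ⊎ v ≡ j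
  arcOf-incident (inj₁ _) inc = inc
  arcOf-incident (inj₂ _) inc = Sum.swap inc

  edge : Fin k → Fin m × Fin m
  edge a = arcOf (adjacent a)

  edges-disjoint : ∀ {a b} → a ≢ b → Disjoint (edge a) (edge b)
  edges-disjoint {a} {b} a≢b v on-a on-b
    with arcOf-incident (adjacent a) on-a | arcOf-incident (adjacent b) on-b
  ... | inj₁ refl | inj₁ eq = a≢b (cover-injective eq)
  ... | inj₁ refl | inj₂ eq = cover≢mate a b eq
  ... | inj₂ refl | inj₁ eq = cover≢mate b a (sym eq)
  ... | inj₂ refl | inj₂ eq = a≢b (mate-injective eq)

  matching : List (Fin m × Fin m)
  matching = tabulate edge

  isMatching : IsMatching H matching
  isMatching = All.tabulate⁺ (λ a → arcOf-arc (adjacent a)) , AllPairs.tabulate⁺ edges-disjoint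

  module _ {N} (isM : IsMatching H N) where

    coverOf : ∀ e → ∃ λ a → Incident (cover a) (lookup N e)
    coverOf e with covers (All.lookup (proj₁ isM) (∈-lookup {xs = N} e))
    ... | inj₁ (a , eq) = a , inj₁ eq
    ... | inj₂ (a , eq) = a , inj₂ eq

    -- A vertex lies on at most one edge of a matching; hence no matching has more than `k` edges.
    coverOf-injective : ∀ {e f} → proj₁ (coverOf e) ≡ proj₁ (coverOf f) → e ≡ f
    coverOf-injective {e} {f} eq = decidable-stable (e ≟ f) λ e≢f →
      allPairs-lookup disjoint-sym (proj₂ isM) e≢f (cover (proj₁ (coverOf e))) (proj₂ (coverOf e))
        (subst (λ a → Incident (cover a) (lookup N f)) (sym eq) (proj₂ (coverOf f)))

  isMaximumMatching : IsMaximumMatching H matching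
  isMaximumMatching = isMatching , λ N isM →
    subst (length N ≤_) (sym (length-tabulate edge)) (injective⇒≤ (coverOf-injective isM))

  cover-saturated : ∀ a → Saturated H (cover a)
  cover-saturated a N (isM , maximum)
    with Any.any? (λ { (i , j) → (cover a ≟ i) ⊎-dec (cover a ≟ j) }) N
  ... | yes inc = inc
  ... | no free = contradiction
    (ℕ.≤-trans (injective⇒≤ extended-injective)
      (subst (_≤ length N) (length-tabulate edge) (maximum matching isMatching)))
    ℕ.1+n≰n
    where
    -- If `N` missed `cover a`, then `a` and the indices covering the edges of `N` would be
    -- `suc (length N)` distinct elements of `Fin k`, although `N` has at least `k` edges.
    extended : Fin (suc (length N)) → Fin k
    extended zero    = a
    extended (suc e) = proj₁ (coverOf isM e)
    missed : ∀ e → a ≢ proj₁ (coverOf isM e)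
    missed e eq = free (Any.map
      (λ { refl → subst (λ b → Incident (cover b) (lookup N e)) (sym eq) (proj₂ (coverOf isM e)) })
      (∈-lookup {xs = N} e))
    extended-injective : ∀ {e f} → extended e ≡ extended f → e ≡ f
    extended-injective {zero}  {zero}  eq = refl
    extended-injective {zero}  {suc f} eq = contradiction eq (missed f)
    extended-injective {suc e} {zero}  eq = contradiction (sym eq) (missed e)
    extended-injective {suc e} {suc f} eq = cong suc (coverOf-injective isM eq)

  -- The edges of the maximum matching `matching` meet only cover vertices and mates.
  unmatched-unsaturated : ∀ {v} → (∀ a → cover a ≢ v) → (∀ a → mate a ≢ v) → ¬ Saturated H v
  unmatched-unsaturated ¬cover ¬mate sat
    with a , inc ← Any.tabulate⁻ (sat matching isMaximumMatching)
    with arcOf-incident (adjacent a) inc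
  ... | inj₁ eq = ¬cover a (sym eq)
  ... | inj₂ eq = ¬mate a (sym eq)

-- Walks and paths

Avoiding : ∀ {A : Set} → Rel A 0ℓ → A → Rel A 0ℓ
Avoiding R i a b = R a b × a ≢ i × b ≢ i

-- Cuts the walk after its last visit to `i`, if any. The condition `s ≢ i` is stated separately
-- because an empty walk of `Avoiding R i` may sit at `i`.
lastExit : ∀ {n} {R : Rel (Fin n) 0ℓ} i {s t} → Star R s t →
  (s ≢ i × Star (Avoiding R i) s t) ⊎ t ≡ i ⊎ ∃ λ k → R i k × k ≢ i × Star (Avoiding R i) k t
lastExit i {s} ε with s ≟ i
... | yes s≡i = inj₂ (inj₁ s≡i)
... | no s≢i  = inj₁ (s≢i , ε)
lastExit i {s} (e ◅ w) with lastExit i w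
... | inj₂ later = inj₂ later
... | inj₁ (k≢i , w′) with s ≟ i
...   | yes refl = inj₂ (inj₂ (_ , e , k≢i , w′))
...   | no s≢i   = inj₁ (s≢i , (e , s≢i , k≢i) ◅ w′)

data Path {A : Set} (R : Rel A 0ℓ) : A → A → List A → Set where
  end : ∀ {i} → Path R i i (i ∷ [])
  _∷_ : ∀ {i j k xs} → R i k → Path R k j xs → Path R i j (i ∷ xs)

module _ {n} {R : Rel (Fin n) 0ℓ} where
  open import Data.List.Membership.DecPropositional (_≟_ {n}) using (_∈?_)

  suffix : ∀ {i j k xs} → Path R k j xs → Unique xs → i ∈ xs → ∃ λ ys → Path R i j ys × Unique ys
  suffix end         u       (here refl) = _ , end , u
  suffix p@(_ ∷ _)   u       (here refl) = _ , p , u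
  suffix (_ ∷ p)     (_ ∷ u) (there i∈)  = suffix p u i∈

  -- If the new first vertex already lies on the path, the path is restarted at that occurrence,
  -- which cuts off a closed detour.
  simplePath : ∀ {i j} → Star R i j → ∃ λ xs → Path R i j xs × Unique xs
  simplePath ε = _ , end , [] ∷ []
  simplePath {i} (r ◅ w) with xs , p , u ← simplePath w with i ∈? xs
  ... | yes i∈ = suffix p u i∈
  ... | no  i∉ = i ∷ xs , r ∷ p , All.¬Any⇒All¬ xs i∉ ∷ u

-- The closing vertex `y` is kept apart from the start for the induction; with `y` equal to the
-- start the pairs are the `cyclicPairs` of the path.
closePath : ∀ {A : Set} {R S : Rel A 0ℓ} → (∀ {a b} → R a b → S a b) →
  ∀ {i j y xs} → Path R i j (i ∷ xs) → S j y →
  All (uncurry S) (zip (i ∷ xs) (xs ∷ʳ y)) × (j , y) ∈ zip (i ∷ xs) (xs ∷ʳ y)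
closePath f end             s = s ∷ [] , here refl
closePath f (r ∷ p@end)     s with all , y∈ ← closePath f p s = f r ∷ all , there y∈
closePath f (r ∷ p@(_ ∷ _)) s with all , y∈ ← closePath f p s = f r ∷ all , there y∈

∈-zip⁻ : ∀ {A B : Set} {a : A} {b : B} xs ys → (a , b) ∈ zip xs ys → a ∈ xs × b ∈ ys
∈-zip⁻ (x ∷ xs) (y ∷ ys) (here refl) = here refl , here refl
∈-zip⁻ (x ∷ xs) (y ∷ ys) (there ab∈) with a∈ , b∈ ← ∈-zip⁻ xs ys ab∈ = there a∈ , there b∈

chain : ∀ {A : Set} {E : Rel A 0ℓ} x xs y → (∀ {a b} → (a , b) ∈ zip (x ∷ xs) (xs ∷ʳ y) → E a b) →
  ∀ {v} → v ∈ x ∷ xs → Star E x v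
chain x xs        y f (here refl) = ε
chain x (x′ ∷ xs) y f (there v∈)  = f (here refl) ◅ chain x′ xs y (f ∘ there) v∈

module _ {n} {G : OrientedGraph n} (C : Cycle G) where
  open OrientedGraph G
  open Cycle C

  edge-sym : Symmetric Edge
  edge-sym = Sum.swap

  cyclicPair-vertices : ∀ {a b} → (a , b) ∈ cyclicPairs vertices → a ∈ vertices × b ∈ vertices
  cyclicPair-vertices ab∈ with vertices
  ... | x ∷ xs with a∈ , b∈ ← ∈-zip⁻ (x ∷ xs) (xs ∷ʳ x) ab∈ =
    a∈ , [ there , (λ { (here eq) → here eq }) ]′ (∈-++⁻ xs b∈)

  edge-vertices : ∀ {a b} → Edge a b → a ∈ vertices × b ∈ vertices
  edge-vertices (inj₁ ab∈) = cyclicPair-vertices ab∈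
  edge-vertices (inj₂ ba∈) with b∈ , a∈ ← cyclicPair-vertices ba∈ = a∈ , b∈

  edge-adj : ∀ {a b} → Edge a b → Adj a b
  edge-adj (inj₁ ab∈) = All.lookup closed ab∈
  edge-adj (inj₂ ba∈) = Sum.swap (All.lookup closed ba∈)

  cycle-connected : ∀ {a b} → a ∈ vertices → b ∈ vertices → Star Edge a b
  cycle-connected {a} {b} a∈ b∈ = go vertices inj₁ a∈ b∈
    where
    go : ∀ xs → (∀ {a b} → (a , b) ∈ cyclicPairs xs → Edge a b) → a ∈ xs → b ∈ xs → Star Edge a b
    go (x ∷ xs) f a∈ b∈ = Star.reverse edge-sym (chain x xs x f a∈) ◅◅ chain x xs x f b∈

path-head : ∀ {A : Set} {R : Rel A 0ℓ} {i j xs} → Path R i j xs → ∃ λ ys → xs ≡ i ∷ ys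
path-head end     = _ , refl
path-head (_ ∷ _) = _ , refl

-- The forest left by deleting the cycle edges.

module Unicyclic {n} (G : OrientedGraph n) (C : Cycle G)
  (connected : Connected G) (unique : IsUniqueCycle G C) where

  module G = OrientedGraph G
  open Cycle C

  OnCycle : Fin n → Set
  OnCycle i = i ∈ vertices

  forest : OrientedGraph n
  forest = withoutCycleEdges G C

  module F = OrientedGraph forest

  forest-adj : ∀ {i j} → F.Adj i j → G.Adj i j
  forest-adj = Sum.map proj₁ proj₁

  forest-¬edge : ∀ {i j} → F.Adj i j → ¬ Edge i j
  forest-¬edge (inj₁ (_ , ¬e)) = ¬e
  forest-¬edge (inj₂ (_ , ¬e)) = ¬e ∘ edge-sym C

  adj-forest : ∀ {i j} → G.Adj i j → ¬ Edge i j → F.Adj i j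
  adj-forest adj ¬e = Sum.map (_, ¬e) (_, ¬e ∘ edge-sym C) adj

  forest-sym : Symmetric F.Adj
  forest-sym = Sum.swap

  module _ {i j : Fin n} where

    OtherEdge : Rel (Fin n) 0ℓ
    OtherEdge a b = G.Adj a b × ¬ ((a ≡ i × b ≡ j) ⊎ (a ≡ j × b ≡ i))

    otherEdge-sym : Symmetric OtherEdge
    otherEdge-sym (adj , other) = Sum.swap adj , λ
      { (inj₁ (b≡i , a≡j)) → other (inj₂ (a≡j , b≡i))
      ; (inj₂ (b≡j , a≡i)) → other (inj₁ (a≡i , b≡j)) }

    -- A path of one step would be the edge between `i` and `j`, which `OtherEdge` excludes.
    longPath : ∀ {xs} → Path OtherEdge j i xs → j ≢ i → 3 ≤ length xs
    longPath end                   j≢i = contradiction refl j≢i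
    longPath (e ∷ end)             j≢i = contradiction (inj₂ (refl , refl)) (proj₂ e)
    longPath (_ ∷ (_ ∷ end))       j≢i = s≤s (s≤s (s≤s z≤n))
    longPath (_ ∷ (_ ∷ (_ ∷ _)))   j≢i = s≤s (s≤s (s≤s z≤n))

    -- A detour around a forest edge would close up to a second cycle.
    forest-bridge : F.Adj i j → ¬ Star OtherEdge j i
    forest-bridge e w with xs , p , u ← simplePath w with xs′ , refl ← path-head p =
      forest-¬edge e (Equivalence.from (unique D i j) (inj₁ (proj₂ closing)))
      where
      closing = closePath proj₁ p (forest-adj e)
      D : Cycle G
      D = record
        { vertices = xs
        ; 3≤length = longPath p λ { refl → adj-irreflexive forest e }
        ; distinct = u
        ; closed   = proj₁ closing }

  Avoid : Fin n → Rel (Fin n) 0ℓ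
  Avoid = Avoiding F.Adj

  avoid⇒other : ∀ {i j a b} → Avoid i a b → OtherEdge {i} {j} a b
  avoid⇒other (e , a≢i , b≢i) = forest-adj e , [ a≢i ∘ proj₁ , b≢i ∘ proj₂ ]′

  edge⇒other : ∀ {i j a b} → F.Adj i j → Edge a b → OtherEdge {i} {j} a b
  edge⇒other e ab = edge-adj C ab , λ
    { (inj₁ (refl , refl)) → forest-¬edge e ab
    ; (inj₂ (refl , refl)) → forest-¬edge e (edge-sym C ab) }

  avoid-forest : ∀ {i a b} → Star (Avoid i) a b → Star F.Adj a b
  avoid-forest = Star.map proj₁

  -- Up i k says that k is the parent of i when every tree of the forest is
  -- rooted at its cycle vertex.
  Up : Fin n → Fin n → Set
  Up i k = F.Adj i k × k ≢ i × ∃ λ c → OnCycle c × Star (Avoid i) k c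

  cycleWalk : ∀ {i j c d} → F.Adj i j → OnCycle c → OnCycle d → Star (OtherEdge {i} {j}) c d
  cycleWalk e c∈ d∈ = Star.map (edge⇒other e) (cycle-connected C c∈ d∈)

  -- Otherwise the walk leaves `c` for the last time through some `k` and reaches `d`; returning to
  -- `c` along the cycle bypasses the forest edge from `c` to `k`.
  separated : ∀ {c d} → OnCycle c → OnCycle d → Star F.Adj c d → c ≡ d
  separated {c} c∈ d∈ w with lastExit c w
  ... | inj₁ (c≢c , _)              = contradiction refl c≢c
  ... | inj₂ (inj₁ d≡c)             = sym d≡c
  ... | inj₂ (inj₂ (k , e , _ , w′)) = contradiction
    (Star.map avoid⇒other w′ ◅◅ cycleWalk e d∈ c∈) (forest-bridge e)

  noForestEdge : ∀ {c d} → OnCycle c → OnCycle d → ¬ F.Adj c d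
  noForestEdge c∈ d∈ e with refl ← separated c∈ d∈ (e ◅ ε) = adj-irreflexive forest e

  -- Two parents would yield a detour around the edge from `i` to `k`: from `k` to the cycle, along
  -- it, back to `l`, and on to `i`.
  up-unique : ∀ {i k l} → Up i k → Up i l → k ≡ l
  up-unique {i} {k} {l} (e , k≢i , c , c∈ , w) (e′ , l≢i , d , d∈ , w′) =
    decidable-stable (k ≟ l) λ k≢l → forest-bridge e
      ((Star.map avoid⇒other w ◅◅ cycleWalk e c∈ d∈ ◅◅
        Star.reverse otherEdge-sym (Star.map avoid⇒other w′)) ◅◅
        (forest-adj (forest-sym e′) , [ l≢i ∘ proj₁ , k≢l ∘ sym ∘ proj₁ ]′) ◅ ε)

  -- From a parent of `c` a walk avoiding `c` reaches a cycle vertex, which is `c` itself by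
  -- `separated`.
  cycle-top : ∀ {c k} → OnCycle c → ¬ Up c k
  cycle-top c∈ (e , k≢c , d , d∈ , w) with refl ← separated c∈ d∈ (e ◅ avoid-forest w) =
    avoids k≢c w refl
    where
    avoids : ∀ {c k d} → k ≢ c → Star (Avoid c) k d → d ≢ c
    avoids k≢c ε                   = k≢c
    avoids k≢c ((_ , _ , l≢c) ◅ w) = avoids l≢c w

  -- A walk to the cycle, stopped where it first meets it, uses forest edges only, since each of its
  -- edges starts off the cycle.
  toCycle : ∀ i → ∃ λ c → OnCycle c × Star F.Adj i c
  toCycle i = go (connected i (proj₁ cycleVertex)) (proj₂ cycleVertex)
    where
    cycleVertex : ∃ OnCycle
    cycleVertex with vertices | 3≤length
    ... | x ∷ _ | _ = x , here refl
    go : ∀ {i c} → Star G.Adj i c → OnCycle c → ∃ λ c → OnCycle c × Star F.Adj i c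
    go ε c∈ = _ , c∈ , ε
    go {i} (e ◅ w) c∈ with vertex? i
    ... | yes i∈ = i , i∈ , ε
    ... | no  i∉ with d , d∈ , w′ ← go w c∈ =
      d , d∈ , adj-forest e (i∉ ∘ proj₁ ∘ edge-vertices C) ◅ w′

  -- On a walk from `j` to the cycle, whichever of `i` and `j` is visited last is the parent of the
  -- other, because the rest of the walk avoids the other.
  forest-up : ∀ {i j} → F.Adj i j → Up i j ⊎ Up j i
  forest-up {i} {j} e with c , c∈ , w ← toCycle j with lastExit i w
  ... | inj₁ (j≢i , w′)  = inj₁ (e , j≢i , c , c∈ , w′)
  ... | inj₂ (inj₁ refl) = inj₂ (forest-sym e , (λ { refl → adj-irreflexive forest e }) , i , c∈ , ε)
  ... | inj₂ (inj₂ (k , f , k≢i , w′)) with lastExit j w′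
  ...   | inj₁ (k≢j , w″) = inj₂ (forest-sym e , i≢j , c , c∈ ,
            (f , i≢j , k≢j) ◅ Star.map (λ { ((g , _) , a≢j , b≢j) → g , a≢j , b≢j }) w″)
    where
    i≢j : i ≢ j
    i≢j refl = adj-irreflexive forest e
  ...   | inj₂ (inj₁ refl) = inj₁ (e , (λ { refl → adj-irreflexive forest e }) , j , c∈ , ε)
  ...   | inj₂ (inj₂ (l , g , _ , w″)) =
            inj₁ (e , (λ { refl → adj-irreflexive forest e }) , c , c∈ , g ◅ Star.map proj₁ w″)

  parent : ∀ i → OnCycle i ⊎ ∃ (Up i)
  parent i with c , c∈ , w ← toCycle i with lastExit i w
  ... | inj₁ (i≢i , _)                = contradiction refl i≢i
  ... | inj₂ (inj₁ refl)              = inj₁ c∈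
  ... | inj₂ (inj₂ (k , e , k≢i , w′)) = inj₂ (k , e , k≢i , c , c∈ , w′)

  -- `Up` quantifies over walks; comparison with the only parent decides it.
  up? : ∀ i k → Dec (Up i k)
  up? i k with parent i
  ... | inj₁ i∈ = no (cycle-top i∈)
  ... | inj₂ (l , u) = map′ (λ { refl → u }) (up-unique u) (l ≟ k)

  -- Cycle vertices have no parent. Accessibility spreads from them backwards along a walk: a child
  -- inherits it from its only parent, and a parent from an accessible child.
  up-wellFounded : WellFounded (flip Up)
  up-wellFounded i with c , c∈ , w ← toCycle i = go w c∈
    where
    go : ∀ {i c} → Star F.Adj i c → OnCycle c → Acc (flip Up) i
    go ε c∈ = acc λ u → contradiction u (cycle-top c∈)
    go (e ◅ w) c∈ with forest-up e
    ... | inj₁ u = acc λ u′ → subst (Acc (flip Up)) (up-unique u u′) (go w c∈)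
    ... | inj₂ u = acc-inverse (go w c∈) u

  up-asym : ∀ {i k} → Up i k → ¬ Up k i
  up-asym u u′ = wf⇒asym up-wellFounded u′ u

  -- The ancestor relation is a strict partial order, irreflexive by `up-wellFounded`, and on
  -- finitely many vertices such an order is well-founded in both directions.
  down-wellFounded : WellFounded Up
  down-wellFounded = Subrelation.wellFounded [_] (spo-noetherian isSPO)
    where
    isSPO : IsStrictPartialOrder _≡_ (TransClosure (flip Up))
    isSPO = record
      { isEquivalence = isEquivalence
      ; irrefl        = wf⇒irrefl (resp₂ _) sym (Trans.wellFounded (flip Up) up-wellFounded)
      ; trans         = Trans._++_
      ; <-resp-≈      = resp₂ _ }

  -- The game of moving to a child.

  data Win (i : Fin n) : Set
  data Lose (i : Fin n) : Set

  data Win i where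
    win : ∀ {k} → Up k i → Lose k → Win i

  data Lose i where
    lose : (∀ {k} → Up k i → Win k) → Lose i

  exclusive : ∀ {i} → Win i → ¬ Lose i
  exclusive (win u l) (lose f) = exclusive (f u) l

  -- Recursion over the children. A winning vertex comes with a particular losing child, which
  -- `mate` reads off.
  status : ∀ i → (∃ λ k → Up k i × Lose k) ⊎ Lose i
  status i = go (down-wellFounded i)
    where
    go : ∀ {i} → Acc Up i → (∃ λ k → Up k i × Lose k) ⊎ Lose i
    go {i} (acc rs) with any? losingChild?
      where
      losingChild? : ∀ k → Dec (Up k i × Lose k)
      losingChild? k with up? k i
      ... | no ¬u = no (¬u ∘ proj₁)
      ... | yes u with go (rs u)
      ...   | inj₁ (_ , u′ , l) = no (exclusive (win u′ l) ∘ proj₂)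
      ...   | inj₂ l            = yes (u , l)
    ... | yes p   = inj₁ p
    ... | no none = inj₂ (lose λ {k} u → [ (λ { (_ , u′ , l) → win u′ l }) , (λ l → contradiction (k , u , l) none) ]′
                                          (go (rs u)))

  win? : ∀ i → Dec (Win i)
  win? i with status i
  ... | inj₁ (_ , u , l) = yes (win u l)
  ... | inj₂ l           = no λ w → exclusive w l

  ¬win⇒lose : ∀ {i} → ¬ Win i → Lose i
  ¬win⇒lose {i} ¬w with status i
  ... | inj₁ (_ , u , l) = contradiction (win u l) ¬w
  ... | inj₂ l           = l

  -- The default `i` at a losing vertex lets `mate-lose` hold at every vertex.
  mate : Fin n → Fin n
  mate i = [ proj₁ , const i ]′ (status i)

  mate-up : ∀ {i} → Win i → Up (mate i) i
  mate-up {i} w with status i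
  ... | inj₁ (_ , u , _) = u
  ... | inj₂ l           = contradiction l (exclusive w)

  mate-lose : ∀ {i} → Lose (mate i)
  mate-lose {i} with status i
  ... | inj₁ (_ , _ , l) = l
  ... | inj₂ l           = l

  -- Of two adjacent vertices one is the parent, and it wins if the child loses.
  win-cover : ∀ {i j} → F.Adj i j → Win i ⊎ Win j
  win-cover {i} {j} e with win? i
  ... | yes w = inj₁ w
  ... | no ¬w with ¬win⇒lose ¬w | forest-up e
  ...   | l      | inj₁ u = inj₂ (win u l)
  ...   | lose f | inj₂ u = inj₂ (f u)

  -- Signs propagated down the forest.

  S : Matrix n n
  S = F.skewAdjacency

  -- On edges the entries of `S` are their own inverses, so with this value the mate adds exactly
  -- `- r` to the row of `w`.
  childValue : Fin n → Fin n → ℚ → ℚ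
  childValue w i r with mate w ≟ i
  ... | yes _ = (- S w i) * r
  ... | no _  = 0ℚ

  childValue-mate : ∀ {w i} r → mate w ≡ i → childValue w i r ≡ (- S w i) * r
  childValue-mate {w} {i} r eq with mate w ≟ i
  ... | yes _ = refl
  ... | no ¬p = contradiction eq ¬p

  childValue-nonmate : ∀ {w i} r → mate w ≢ i → childValue w i r ≡ 0ℚ
  childValue-nonmate {w} {i} r ¬eq with mate w ≟ i
  ... | yes eq = contradiction eq ¬eq
  ... | no _   = refl

  childValue-zero : ∀ w i {r} → r ≡ 0ℚ → childValue w i r ≡ 0ℚ
  childValue-zero w i refl with mate w ≟ i
  ... | yes _ = ℚ.*-zeroʳ (- S w i)
  ... | no _  = refl

  -- A losing root `c` starts with 1 and yields a kernel vector of `S`. A winning one starts with 0,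
  -- and the target `unit c` enters through the inflow.
  rootValue : Fin n → Fin n → ℚ
  rootValue c i = [ const 0ℚ , const (unit c i) ]′ (status i)

  rootValue-win : ∀ c {i} → Win i → rootValue c i ≡ 0ℚ
  rootValue-win c {i} w with status i
  ... | inj₁ _ = refl
  ... | inj₂ l = contradiction l (exclusive w)

  rootValue-lose : ∀ c {i} → Lose i → rootValue c i ≡ unit c i
  rootValue-lose c {i} l with status i
  ... | inj₁ (_ , u , l′) = contradiction l (exclusive (win u l′))
  ... | inj₂ _            = refl

  -- A vector supported on the losing vertices, propagated from the root c
  -- downwards so that the rows of S at winning vertices balance: the second
  -- component is the part of the row of i contributed by its parent, less the
  -- target unit c i, and the mate of i compensates for it.
  module _ (c : Fin n) where

    propagate : ∀ {i} → Acc (flip Up) i → ℚ × ℚ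
    propagate {i} (acc rs) with parent i
    ... | inj₁ _       = rootValue c i , - unit c i
    ... | inj₂ (w , u) = childValue w i (proj₂ (propagate (rs u))) , S i w * proj₁ (propagate (rs u))

    -- `value` and `inflow` fix one accessibility proof, while the recursion meets another at the
    -- parent.
    propagate-irrelevant : ∀ {i} (a b : Acc (flip Up) i) → propagate a ≡ propagate b
    propagate-irrelevant {i} (acc rs) (acc rs′) with parent i
    ... | inj₁ _       = refl
    ... | inj₂ (w , u) = cong (λ p → childValue w i (proj₂ p) , S i w * proj₁ p)
                              (propagate-irrelevant (rs u) (rs′ u))

    value inflow : Fin n → ℚ
    value  i = proj₁ (propagate (up-wellFounded i))
    inflow i = proj₂ (propagate (up-wellFounded i))

    propagate-root : ∀ {i} → OnCycle i → (a : Acc (flip Up) i) → propagate a ≡ (rootValue c i , - unit c i)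
    propagate-root {i} i∈ (acc _) with parent i
    ... | inj₁ _       = refl
    ... | inj₂ (_ , u) = contradiction u (cycle-top i∈)

    propagate-child : ∀ {i w} → Up i w → (a : Acc (flip Up) i) →
      propagate a ≡ (childValue w i (inflow w) , S i w * value w)
    propagate-child {i} {w} u (acc rs) with parent i
    ... | inj₁ i∈       = contradiction u (cycle-top i∈)
    ... | inj₂ (w′ , u′) with refl ← up-unique u u′ =
      cong (λ p → childValue w i (proj₂ p) , S i w * proj₁ p)
           (propagate-irrelevant (rs u′) (up-wellFounded w))

    value-root : ∀ {i} → OnCycle i → value i ≡ rootValue c i
    value-root i∈ = cong proj₁ (propagate-root i∈ (up-wellFounded _))

    inflow-root : ∀ {i} → OnCycle i → inflow i ≡ - unit c i
    inflow-root i∈ = cong proj₂ (propagate-root i∈ (up-wellFounded _))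

    value-child : ∀ {i w} → Up i w → value i ≡ childValue w i (inflow w)
    value-child u = cong proj₁ (propagate-child u (up-wellFounded _))

    inflow-child : ∀ {i w} → Up i w → inflow i ≡ S i w * value w
    inflow-child u = cong proj₂ (propagate-child u (up-wellFounded _))

    value-win : ∀ {i} → Win i → value i ≡ 0ℚ
    value-win {i} w with parent i
    ... | inj₁ i∈      = trans (value-root i∈) (rootValue-win c w)
    ... | inj₂ (p , u) = trans (value-child u) (childValue-nonmate (inflow p)
      λ { refl → exclusive w mate-lose })

    value-unreachable : ∀ {i} → ¬ F.Reachable c i → value i ≡ 0ℚ
    value-unreachable {i} = proj₁ ∘ go (up-wellFounded i)
      where
      -- Both components are needed in the induction: the value depends on the inflow at the parent,
      -- and the inflow on the value there.
      go : ∀ {i} → Acc (flip Up) i → ¬ F.Reachable c i → value i ≡ 0ℚ × inflow i ≡ 0ℚ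
      go {i} (acc rs) ¬r with parent i
      ... | inj₁ i∈ =
        trans (value-root i∈) (rootZero (status i)) , trans (inflow-root i∈) (cong -_ unit≡0)
        where
        unit≡0 : unit c i ≡ 0ℚ
        unit≡0 = unit-off c i λ { refl → ¬r ε }
        rootZero : ∀ s → [ const 0ℚ , const (unit c i) ]′ s ≡ 0ℚ
        rootZero (inj₁ _) = refl
        rootZero (inj₂ _) = unit≡0
      ... | inj₂ (w , u) with value≡0 , inflow≡0 ← go (rs u) (λ r → ¬r (r ◅◅ forest-sym (proj₁ u) ◅ ε)) =
        trans (value-child u) (childValue-zero w i inflow≡0) ,
        trans (inflow-child u) (trans (cong (S i w *_) value≡0) (ℚ.*-zeroʳ (S i w)))

    S-value-nonadjacent : ∀ {i j} → ¬ F.Adj i j → S i j * value j ≡ 0ℚ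
    S-value-nonadjacent {i} {j} ¬e =
      trans (cong (_* value j) (skewAdjacency-nonadjacent forest ¬e)) (ℚ.*-zeroˡ (value j))

    S-value-zero : ∀ {i j} → value j ≡ 0ℚ → S i j * value j ≡ 0ℚ
    S-value-zero {i} {j} eq = trans (cong (S i j *_) eq) (ℚ.*-zeroʳ (S i j))

    -- Every neighbour of a losing vertex wins, a parent by moving to it, and so has value 0.
    row-lose : ∀ {i} → Lose i → sum (λ j → S i j * value j) ≡ 0ℚ
    row-lose {i} (lose f) = sum-zero term
      where
      term : ∀ j → S i j * value j ≡ 0ℚ
      term j with F.adj? i j
      ... | no ¬e = S-value-nonadjacent ¬e
      ... | yes e with forest-up e
      ...   | inj₁ u = S-value-zero (value-win (win u (lose f)))
      ...   | inj₂ u = S-value-zero (value-win (f u))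

    mate-term : ∀ {i} → Win i → S i (mate i) * value (mate i) ≡ - inflow i
    mate-term {i} w = begin
      S i m * value m                  ≡⟨ cong (S i m *_) (trans (value-child u) (childValue-mate (inflow i) refl)) ⟩
      S i m * ((- S i m) * inflow i)   ≡⟨ solve 2 (λ s r → s :* ((:- s) :* r) := :- (s :* s :* r)) refl (S i m) (inflow i) ⟩
      - (S i m * S i m * inflow i)     ≡⟨ cong (λ z → - (z * inflow i)) (skewAdjacency-square forest (forest-sym (proj₁ u))) ⟩
      - (1ℚ * inflow i)                ≡⟨ cong -_ (ℚ.*-identityˡ (inflow i)) ⟩
      - inflow i                       ∎
      where
      open ≡-Reasoning
      m = mate i
      u = mate-up w

    child-term : ∀ {i j} → Up j i → j ≢ mate i → S i j * value j ≡ 0ℚ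
    child-term {i} u j≢m = S-value-zero (trans (value-child u) (childValue-nonmate (inflow i) (j≢m ∘ sym)))

    -- Only the mate and the parent contribute. The mate cancels the inflow, which is the
    -- contribution of the parent or, at a cycle vertex, minus the target.
    row-win : ∀ {i} → Win i → OnCycle c → sum (λ j → S i j * value j) ≡ unit c i
    row-win {i} w c∈ with parent i
    ... | inj₁ i∈ = begin
      sum (λ j → S i j * value j)   ≡⟨ sum-single _ (mate i) others ⟩
      S i (mate i) * value (mate i) ≡⟨ mate-term w ⟩
      - inflow i                    ≡⟨ cong -_ (inflow-root i∈) ⟩
      - (- unit c i)                ≡⟨ solve 1 (λ x → :- (:- x) := x) refl (unit c i) ⟩
      unit c i                      ∎
      where
      open ≡-Reasoning
      others : ∀ j → j ≢ mate i → S i j * value j ≡ 0ℚ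
      others j j≢m with F.adj? i j
      ... | no ¬e = S-value-nonadjacent ¬e
      ... | yes e = child-term ([ (λ u → contradiction u (cycle-top i∈)) , (λ u → u) ]′ (forest-up e)) j≢m
    ... | inj₂ (p , u) = begin
      sum (λ j → S i j * value j)                     ≡⟨ sum-pair _ mate≢p others ⟩
      S i (mate i) * value (mate i) + S i p * value p ≡⟨ cong₂ _+_ (mate-term w) (sym (inflow-child u)) ⟩
      - inflow i + inflow i                           ≡⟨ ℚ.+-inverseˡ (inflow i) ⟩
      0ℚ                                              ≡⟨ sym (unit-off c i λ { refl → cycle-top c∈ u }) ⟩
      unit c i                                        ∎
      where
      open ≡-Reasoning
      mate≢p : mate i ≢ p
      mate≢p eq = up-asym u (subst (λ m → Up m i) eq (mate-up w))
      others : ∀ j → j ≢ mate i → j ≢ p → S i j * value j ≡ 0ℚ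
      others j j≢m j≢p with F.adj? i j
      ... | no ¬e = S-value-nonadjacent ¬e
      ... | yes e with forest-up e
      ...   | inj₁ u′ = contradiction (up-unique u′ u) j≢p
      ...   | inj₂ u′ = child-term u′ j≢m

  -- Saturation of the root decided by the game.

  module _ {v : Fin n} (v∈ : OnCycle v) where

    tree? : U.Decidable (F.Reachable v)
    tree? = inTree? G C v

    vertex : Fin (length (members tree?)) → Fin n
    vertex = member tree?

    winning? : U.Decidable (Win ∘ vertex)
    winning? a = win? (vertex a)

    winner : Fin (length (members winning?)) → Fin (length (members tree?))
    winner = member winning?

    winner-wins : ∀ a → Win (vertex (winner a))
    winner-wins = member-satisfies winning?

    mate-inTree : ∀ a → F.Reachable v (mate (vertex (winner a)))
    mate-inTree a = member-satisfies tree? (winner a) ◅◅ forest-sym (proj₁ (mate-up (winner-wins a))) ◅ ε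

    winnerMate : Fin (length (members winning?)) → Fin (length (members tree?))
    winnerMate a = position tree? (mate-inTree a)

    winnerMate-vertex : ∀ a → vertex (winnerMate a) ≡ mate (vertex (winner a))
    winnerMate-vertex a = member-position tree? (mate-inTree a)

    root-vertex : vertex (root G C v) ≡ v
    root-vertex = member-position tree? ε

    winner-index : ∀ {a} → Win (vertex a) → ∃ λ b → winner b ≡ a
    winner-index w = position winning? w , member-position winning? w

    private
      -- The winning vertices of the tree form the cover. Mates are distinct because a child has
      -- only one parent, and lie outside the cover because they lose.
      module M = MatchedCover (treeAt G C v) winner winnerMate
        (member-injective winning?)
        (λ {a} {b} eq → member-injective winning? (member-injective tree? (up-unique
          (mate-up (winner-wins a))
          (subst (λ m → Up m (vertex (winner b)))
            (trans (sym (winnerMate-vertex b)) (trans (cong vertex (sym eq)) (winnerMate-vertex a)))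
            (mate-up (winner-wins b))))))
        (λ a b eq → exclusive (winner-wins a)
          (subst Lose (sym (trans (cong vertex eq) (winnerMate-vertex b))) mate-lose))
        (λ a → subst (F.Adj (vertex (winner a))) (sym (winnerMate-vertex a))
          (forest-sym (proj₁ (mate-up (winner-wins a)))))
        (λ arc → Sum.map winner-index winner-index (win-cover (inj₁ arc)))

    win⇒saturated : Win v → Saturated (treeAt G C v) (root G C v)
    win⇒saturated w with a , eq ← winner-index (subst Win (sym root-vertex) w) =
      subst (Saturated (treeAt G C v)) eq (M.cover-saturated a)

    -- The root is not in the cover, as it loses, and is no mate, as mates have parents.
    lose⇒unsaturated : Lose v → ¬ Saturated (treeAt G C v) (root G C v)
    lose⇒unsaturated l = M.unmatched-unsaturated
      (λ a eq → exclusive (subst Win (trans (cong vertex eq) root-vertex) (winner-wins a)) l)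
      (λ a eq → cycle-top v∈ (subst (λ m → Up m (vertex (winner a)))
        (trans (sym (winnerMate-vertex a)) (trans (cong vertex eq) root-vertex))
        (mate-up (winner-wins a))))

  -- The two rank formulas.

  A : Matrix n n
  A = G.skewAdjacency

  A≡S : ∀ {i j} → ¬ Edge i j → S i j ≡ A i j
  A≡S ¬e = skewAdjacency-keepArcs G (λ i j → ¬? (edge? i j)) (const ¬e) (const (¬e ∘ edge-sym C))

  -- Only `v` joins the tree to the rest of `G`. So a column `j` outside the tree, cut off to the
  -- tree, is `A v j` times the unit vector at `v`, which is solved by scaling `value v`.
  rank-saturated : ∀ {v} → OnCycle v → Win v → sr G ≡ sr (treeAt G C v) ℕ.+ sr (withoutTreeAt G C v)
  rank-saturated {v} v∈ w = trans
    (rank-split A (skewAdjacency-skew G) T? (∁? T?) cover X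
      (λ j k _ ¬Tk → trans (cong (A v j *_) (value-unreachable v ¬Tk)) (ℚ.*-zeroʳ (A v j)))
      solves kills)
    (cong (ℕ._+ sr (withoutTreeAt G C v))
      (rank-cong λ a b → sym (A≡S (tree-¬edge (member-satisfies T? a) (member-satisfies T? b)))))
    where
    open ≡-Reasoning
    T = F.Reachable v
    T? = inTree? G C v
    X : Matrix n n
    X j k = A v j * value v k
    cover : ∀ i → T i ⊎ ¬ T i
    cover i with T? i
    ... | yes t = inj₁ t
    ... | no ¬t = inj₂ ¬t
    tree-¬edge : ∀ {i j} → T i → T j → ¬ Edge i j
    tree-¬edge ti tj e with edge-vertices C e
    ... | i∈ , j∈ with refl ← separated v∈ i∈ ti | refl ← separated v∈ j∈ tj =
      adj-irreflexive G (edge-adj C e)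
    boundary : ∀ {i j} → T i → ¬ T j → i ≢ v → ¬ G.Adj i j
    boundary {i} {j} ti ¬tj i≢v adj with edge? i j
    ... | yes e = i≢v (sym (separated v∈ (proj₁ (edge-vertices C e)) ti))
    ... | no ¬e = ¬tj (ti ◅◅ adj-forest adj ¬e ◅ ε)
    entry : ∀ {i} k → T i → A i k * value v k ≡ S i k * value v k
    entry {i} k ti with T? k
    ... | yes tk = cong (_* value v k) (sym (A≡S (tree-¬edge ti tk)))
    ... | no ¬tk = trans (zero≡ (A i k)) (sym (zero≡ (S i k)))
      where
      zero≡ : ∀ x → x * value v k ≡ 0ℚ
      zero≡ x = trans (cong (x *_) (value-unreachable v ¬tk)) (ℚ.*-zeroʳ x)
    row : ∀ i → sum (λ k → S i k * value v k) ≡ unit v i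
    row i with win? i
    ... | yes wi = row-win v wi v∈
    ... | no ¬wi = trans (row-lose v (¬win⇒lose ¬wi)) (sym (unit-off v i λ { refl → ¬wi w }))
    solves : ∀ i j → T i → ¬ T j → sum (λ k → A i k * X j k) ≡ A i j
    solves i j ti ¬tj = begin
      sum (λ k → A i k * (A v j * value v k))
        ≡⟨ sum-cong-≗ (λ k → trans
             (solve 3 (λ a b x → a :* (b :* x) := b :* (a :* x)) refl (A i k) (A v j) (value v k))
             (cong (A v j *_) (entry k ti))) ⟩
      sum (λ k → A v j * (S i k * value v k))
        ≡⟨ sym (*-distribˡ-sum (A v j) (λ k → S i k * value v k)) ⟩
      A v j * sum (λ k → S i k * value v k) ≡⟨ cong (A v j *_) (row i) ⟩
      A v j * unit v i                      ≡⟨ atRoot ⟩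
      A i j                                 ∎
      where
      atRoot : A v j * unit v i ≡ A i j
      atRoot with i ≟ v
      ... | yes refl = ℚ.*-identityʳ (A v j)
      ... | no i≢v   = trans (ℚ.*-zeroʳ (A v j)) (sym (skewAdjacency-nonadjacent G (boundary ti ¬tj i≢v)))
    kills : ∀ i j → ¬ T i → ¬ T j → sum (λ k → A i k * X j k) ≡ 0ℚ
    kills i j ¬ti ¬tj = sum-zero term
      where
      vanishing : ∀ {k} → value v k ≡ 0ℚ → A i k * X j k ≡ 0ℚ
      vanishing {k} eq = trans (cong (λ x → A i k * (A v j * x)) eq)
        (trans (cong (A i k *_) (ℚ.*-zeroʳ (A v j))) (ℚ.*-zeroʳ (A i k)))
      term : ∀ k → A i k * X j k ≡ 0ℚ
      -- Outside the tree, and at the winning vertex `v`, the value is 0; any other tree vertex has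
      -- no neighbour `i` outside.
      term k with T? k | k ≟ v
      ... | no ¬tk | _        = vanishing (value-unreachable v ¬tk)
      ... | yes _  | yes refl = vanishing (value-win v w)
      ... | yes tk | no k≢v   = trans
        (cong (_* X j k) (skewAdjacency-nonadjacent G (boundary tk ¬ti k≢v ∘ Sum.swap)))
        (ℚ.*-zeroˡ (X j k))

  -- The elimination uses the columns outside the cycle. For a losing `j` the vector `value j` lies
  -- in the kernel of `S`, so subtracting it from `unit j` keeps the image, the column `j` of `S`.
  rank-unsaturated : (∀ v → OnCycle v → Lose v) → sr G ≡ sr (cycleGraph G C) ℕ.+ sr (withoutCycle G C)
  rank-unsaturated allLose = begin
    sr G
      ≡⟨ rank-split A (skewAdjacency-skew G) (∁? vertex?) vertex? cover X support solves kills ⟩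
    sr (withoutCycle G C) ℕ.+ rank (restrict vertex? A)
      ≡⟨ ℕ.+-comm (sr (withoutCycle G C)) _ ⟩
    rank (restrict vertex? A) ℕ.+ sr (withoutCycle G C)
      ≡⟨ cong (ℕ._+ sr (withoutCycle G C)) (rank-cong λ a b → sym (cycleEntry
           (member-satisfies vertex? a) (member-satisfies vertex? b))) ⟩
    sr (cycleGraph G C) ℕ.+ sr (withoutCycle G C) ∎
    where
    open ≡-Reasoning
    cover : ∀ i → ¬ OnCycle i ⊎ OnCycle i
    cover i with vertex? i
    ... | yes i∈ = inj₂ i∈
    ... | no i∉  = inj₁ i∉
    -- A chord would be a forest edge between cycle vertices; hence `cycleGraph` has the same matrix
    -- as the induced subgraph.
    chordless : ∀ {i j} → OnCycle i → OnCycle j → G.Adj i j → Edge i j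
    chordless {i} {j} i∈ j∈ adj = decidable-stable (edge? i j) (noForestEdge i∈ j∈ ∘ adj-forest adj)
    cycleEntry : ∀ {i j} → OnCycle i → OnCycle j →
      OrientedGraph.skewAdjacency (keepArcs G edge?) i j ≡ A i j
    cycleEntry i∈ j∈ = skewAdjacency-keepArcs G edge? (chordless i∈ j∈ ∘ inj₁) (chordless j∈ i∈ ∘ inj₁)
    -- On the cycle `value j` agrees with `unit j`, so the difference is supported off the cycle.
    X : Matrix n n
    X j k = unit j k + - value j k
    support : ∀ j k → OnCycle j → ¬ ¬ OnCycle k → X j k ≡ 0ℚ
    support j k _ ¬k∉ = trans
      (cong (λ x → unit j k + - x) (trans (value-root j k∈) (rootValue-lose j (allLose k k∈))))
      (ℚ.+-inverseʳ (unit j k))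
      where k∈ = decidable-stable (vertex? k) ¬k∉
    row : ∀ i {j} → OnCycle j → sum (λ k → S i k * X j k) ≡ S i j
    row i {j} j∈ = begin
      sum (λ k → S i k * (unit j k + - value j k))
        ≡⟨ sum-cong-≗ (λ k → solve 3 (λ s u x → s :* (u :+ :- x) := s :* u :+ :- (s :* x)) refl
             (S i k) (unit j k) (value j k)) ⟩
      sum (λ k → S i k * unit j k + - (S i k * value j k))
        ≡⟨ ∑-distrib-+ (λ k → S i k * unit j k) (λ k → - (S i k * value j k)) ⟩
      sum (λ k → S i k * unit j k) + sum (λ k → - (S i k * value j k))
        ≡⟨ cong₂ _+_ (sum-unit (S i) j) (trans (sum-neg λ k → S i k * value j k) (cong -_ kernel)) ⟩
      S i j + - 0ℚ
        ≡⟨ ℚ.+-identityʳ (S i j) ⟩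
      S i j ∎
      where
      kernel : sum (λ k → S i k * value j k) ≡ 0ℚ
      kernel with win? i
      ... | yes w = trans (row-win j w j∈) (unit-off j i λ { refl → exclusive w (allLose j j∈) })
      ... | no ¬w = row-lose j (¬win⇒lose ¬w)
    solves : ∀ i j → ¬ OnCycle i → OnCycle j → sum (λ k → A i k * X j k) ≡ A i j
    solves i j i∉ j∈ = begin
      sum (λ k → A i k * X j k) ≡⟨ sum-cong-≗ (λ k → cong (_* X j k) (sym (A≡S (i∉ ∘ proj₁ ∘ edge-vertices C)))) ⟩
      sum (λ k → S i k * X j k) ≡⟨ row i j∈ ⟩
      S i j                     ≡⟨ A≡S (i∉ ∘ proj₁ ∘ edge-vertices C) ⟩
      A i j                     ∎
    kills : ∀ i j → OnCycle i → OnCycle j → sum (λ k → A i k * X j k) ≡ 0ℚ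
    kills i j i∈ j∈ = begin
      sum (λ k → A i k * X j k) ≡⟨ sum-cong-≗ entry ⟩
      sum (λ k → S i k * X j k) ≡⟨ row i j∈ ⟩
      S i j                     ≡⟨ skewAdjacency-nonadjacent forest (noForestEdge i∈ j∈) ⟩
      0ℚ                        ∎
      where
      -- `A` and `S` differ only on cycle edges, where `k` is on the cycle and `X j k` vanishes.
      entry : ∀ k → A i k * X j k ≡ S i k * X j k
      entry k with vertex? k
      ... | yes k∈ = trans (vanishing (A i k)) (sym (vanishing (S i k)))
        where
        vanishing : ∀ x → x * X j k ≡ 0ℚ
        vanishing x = trans (cong (x *_) (support j k j∈ λ k∉ → k∉ k∈)) (ℚ.*-zeroʳ x)
      ... | no k∉ = cong (_* X j k) (sym (A≡S (k∉ ∘ proj₂ ∘ edge-vertices C)))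

theorem4p5 : ∀ (n : ℕ) (G : OrientedGraph n) (C : Cycle G) →
    Connected G → IsUniqueCycle G C →
    (∀ v → v ∈ Cycle.vertices C → Saturated (treeAt G C v) (root G C v) →
    sr G ≡ sr (treeAt G C v) ℕ.+ sr (withoutTreeAt G C v))
    ×
    ((∀ v → v ∈ Cycle.vertices C → ¬ Saturated (treeAt G C v) (root G C v)) →
    sr G ≡ sr (cycleGraph G C) ℕ.+ sr (withoutCycle G C))
theorem4p5 n G C connected unique =
  (λ v v∈ sat → rank-saturated v∈ (decidable-stable (win? v) λ ¬w →
    lose⇒unsaturated v∈ (¬win⇒lose ¬w) sat)) ,
  (λ unsat → rank-unsaturated λ v v∈ → ¬win⇒lose λ w → unsat v v∈ (win⇒saturated v∈ w))
  where open Unicyclic G C connected unique
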